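{- Let $\mu$ be a given partition. For every integer $n\ge|\mu|$, $$\sum_{|\lambda|=n,\ \lambda\supseteq\mu}\frac{H_\mu f_{\lambda/\mu}}{H_\lambda}\bigl(C(\lambda,1)-C(\mu,1)\bigr)=\frac12(n-|\mu|)(n+|\mu|-1).$$
   Context: Partitions are identified with Young diagrams; the box in row $i$, column $j$ has content $c_\square=j-i$; $h_\square$ is the hook length (arm + leg + 1), $H_\lambda=\prod_{\square\in\lambda}h_\square$, $H_\emptyset=1$. $f_{\lambda/\mu}$ is the number of standard Young tableaux of skew shape $\lambda/\mu$ ($f_{\mu/\mu}=1$). $C(\lambda,1)=\sum_{\square\in\lambda}c_\square^2$. -}

module Defs where

open import Data.Bool using (Bool; true; false; _∧_; not; if_then_else_)
open import Data.Nat using (ℕ; zero; suc; _+_; _*_; _∸_; _^_; _≤_; _<_; _<ᵇ_; _≡ᵇ_; NonZero)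
open import Data.Nat.Properties using (m*n≢0)
open import Data.Nat.ListAction using (sum; product)
open import Data.List using (List; []; _∷_; length; map; concatMap; upTo; filterᵇ; zip; lookup; applyUpTo)
open import Data.List.Relation.Unary.All using (All)
open import Data.List.Relation.Unary.Linked using (Linked)
open import Data.Product using (_×_; _,_; proj₁; proj₂)
open import Data.Integer using (+_)
open import Data.Rational using (ℚ; 0ℚ; _/_; _-_) renaming (_+_ to _+ℚ_)
open import Relation.Binary.PropositionalEquality using (_≡_)

IsPartition : List ℕ → Set
IsPartition la = Linked (λ a b → b ≤ a) la × All (λ a → 0 < a) la

size : List ℕ → ℕ
size = sum

row : List ℕ → ℕ → ℕ
row []       _       = 0
row (a ∷ _)  zero    = a
row (_ ∷ as) (suc i) = row as i

col : List ℕ → ℕ → ℕ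
col la j = length (filterᵇ (λ a → j <ᵇ a) la)

_⊆_ : List ℕ → List ℕ → Set
mu ⊆ la = ∀ i → row mu i ≤ row la i

-- Cells (i , j) of the Young diagram (0-indexed row i, column j), row-major order
Cell : Set
Cell = ℕ × ℕ

cellsFrom : ℕ → List ℕ → List Cell
cellsFrom i []       = []
cellsFrom i (a ∷ as) = map (λ j → i , j) (upTo a) Data.List.++ cellsFrom (suc i) as

cells : List ℕ → List Cell
cells = cellsFrom 0

hook : List ℕ → Cell → ℕ
hook la (i , j) = suc ((row la i ∸ suc j) + (col la j ∸ suc i))

hookProduct : List ℕ → ℕ
hookProduct la = product (map (hook la) (cells la))

private
  prodSuc-nz : (xs : List Cell) (g : Cell → ℕ) → NonZero (product (map (λ c → suc (g c)) xs))
  prodSuc-nz []       g = _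
  prodSuc-nz (x ∷ xs) g = m*n≢0 (suc (g x)) _ {{_}} {{prodSuc-nz xs g}}

hookProduct-nonZero : (la : List ℕ) → NonZero (hookProduct la)
hookProduct-nonZero la =
  prodSuc-nz (cells la) (λ c → (row la (proj₁ c) ∸ suc (proj₂ c)) + (col la (proj₂ c) ∸ suc (proj₁ c)))

contentSq : Cell → ℕ
contentSq (i , j) = ((j ∸ i) + (i ∸ j)) ^ 2

C1 : List ℕ → ℕ
C1 la = sum (map contentSq (cells la))

skewCells : List ℕ → List ℕ → List Cell
skewCells la mu = filterᵇ (λ c → row mu (proj₁ c) ≤ᵇ' proj₂ c) (cells la)
  where
  _≤ᵇ'_ : ℕ → ℕ → Bool
  a ≤ᵇ' b = a <ᵇ suc b

words : ℕ → List ℕ → List (List ℕ)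
words zero    A = [] ∷ []
words (suc k) A = concatMap (λ a → map (a ∷_) (words k A)) A

elemᵇ : ℕ → List ℕ → Bool
elemᵇ x []       = false
elemᵇ x (y ∷ ys) = if x ≡ᵇ y then true else elemᵇ x ys

distinctᵇ : List ℕ → Bool
distinctᵇ []       = true
distinctᵇ (x ∷ xs) = not (elemᵇ x xs) ∧ distinctᵇ xs

allᵇ : {A : Set} → (A → Bool) → List A → Bool
allᵇ p []       = true
allᵇ p (x ∷ xs) = p x ∧ allᵇ p xs

adjacentᵇ : Cell → Cell → Bool
adjacentᵇ (i , j) (i' , j') = ((i ≡ᵇ i') ∧ (suc j ≡ᵇ j')) Data.Bool.∨ ((suc i ≡ᵇ i') ∧ (j ≡ᵇ j'))

-- a filling (values listed along the skew cells) is a standard Young tableau: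
-- the values (taken from {1..k}) are distinct, and increase along rows and down columns
isSYTᵇ : List Cell → List ℕ → Bool
isSYTᵇ cs vs =
  distinctᵇ vs ∧
  allᵇ (λ p → allᵇ (λ q → if adjacentᵇ (proj₁ p) (proj₁ q) then proj₂ p <ᵇ proj₂ q else true) cv) cv
  where cv = zip cs vs

numSYT : List ℕ → List ℕ → ℕ
numSYT la mu = length (filterᵇ (isSYTᵇ cs) (words k (applyUpTo suc k)))
  where
  cs = skewCells la mu
  k  = length cs

ℕ→ℚ : ℕ → ℚ
ℕ→ℚ n = + n / 1

sumℚ : List ℚ → ℚ
sumℚ []       = 0ℚ
sumℚ (x ∷ xs) = x +ℚ sumℚ xs

summand : List ℕ → List ℕ → ℚ
summand mu la =
  (_/_ (+ (hookProduct mu * numSYT la mu)) (hookProduct la) {{hookProduct-nonZero la}}) Data.Rational.* (ℕ→ℚ (C1 la) - ℕ→ℚ (C1 mu))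

{-# OPTIONS --safe #-}
-- Weight the Plancherel growth step μ → μ ∪ □ by H_μ / H_{μ ∪ □}. Over the addable boxes of μ
-- these weights have total mass 1, and the second moment of the content of the added box is |μ|
-- (Kerov). Hence C(λ,1) − |λ|(|λ|−1)/2 + k is harmonic for the growth for every constant k.
-- Removing the smallest entry of a standard tableau gives f_{λ/μ} = Σ f_{λ/(μ ∪ □)} over the boxes
-- □ ∈ λ addable to μ, so by induction on n − |μ| every harmonic function h satisfies
-- Σ_λ (H_μ f_{λ/μ} / H_λ) h(λ) = h(μ); the theorem is the case k = n(n−1)/2 − C(μ,1).
-- The moments are computed by peeling off the first row: if a row of length a is put on top of a
-- partition, the weight of a box with content c in that partition is multiplied by
-- 1 − 1/(a+1−c), and the new first row receives the mass Σ weight/(a+1−c) that is lost.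
module Submission where

open import Defs
open import Data.Bool using (Bool; true; false; T; _∧_; if_then_else_)
open import Data.Bool.Properties using (T-∧; T-∨; T?)
import Data.Integer as ℤ
import Data.Integer.Properties as ℤ
open import Data.List using (List; []; _∷_; length; map; upTo; applyUpTo; filter; filterᵇ; _++_; concatMap; zip)
open import Data.List.Properties using (length-++; length-map; length-applyUpTo; map-∘; map-++; map-upTo; map-cong-local; filter-all; filter-none; filter-accept; filter-reject; upTo-∷ʳ; ∷-injectiveˡ; ∷-injectiveʳ)
open import Data.List.Membership.DecPropositional using (_∈?_)
open import Data.List.Membership.Propositional using (_∈_; lose; find)
open import Data.List.Membership.Propositional.Properties using (∈-∃++; ∈-++⁺ˡ; ∈-++⁺ʳ; ∈-++⁻; ∈-map⁺; ∈-map⁻; ∈-filter⁺; ∈-filter⁻; ∈-concatMap⁺; ∈-concatMap⁻; ∈-applyUpTo⁺; ∈-applyUpTo⁻; ∈-upTo⁺; ∈-upTo⁻; ∉[])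
open import Data.List.Membership.Propositional.Properties.WithK using (unique∧set⇒bag)
open import Data.List.Relation.Binary.BagAndSetEquality using (∼bag⇒↭)
open import Data.List.Relation.Binary.Permutation.Propositional.Properties using (↭-length)
open import Data.List.Relation.Unary.All as All using (All; []; _∷_)
import Data.List.Relation.Unary.All.Properties as All
open import Data.List.Relation.Unary.AllPairs using ([]; _∷_)
open import Data.List.Relation.Unary.Any using (here; there)
open import Data.List.Relation.Unary.Linked as Linked using (Linked; []; [-]; _∷_)
open import Data.List.Relation.Unary.Unique.Propositional using (Unique)
import Data.List.Relation.Unary.Unique.Propositional.Properties as Unique
open import Data.Nat as ℕ using (ℕ; zero; suc; pred; z≤n; s≤s; _∸_; _≤_; _<_; _<ᵇ_; _≡ᵇ_)
import Data.Nat.Properties as ℕ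
open import Data.Nat.ListAction using (sum; product)
open import Data.Nat.ListAction.Properties using (sum-++; product-++)
open import Data.Product using (_×_; _,_; proj₁; proj₂; ∃)
open import Data.Product.Properties using (≡-dec; ,-injectiveˡ; ,-injectiveʳ)
open import Data.Rational using (ℚ; 0ℚ; 1ℚ; ½; _+_; _*_; _-_; -_; _/_; toℚᵘ)
import Data.Rational.Properties as ℚ
import Data.Rational.Unnormalised as ℚᵘ
open ℚᵘ using (mkℚᵘ; *≡*)
import Data.Rational.Unnormalised.Properties as ℚᵘ
open import Data.Sum using (_⊎_; inj₁; inj₂)
open import Data.Unit using (tt)
open import Function using (_∘_; id; _⇔_; mk⇔; Equivalence)
open Equivalence using (to; from)
open import Level using (0ℓ)
open import Relation.Binary.Definitions using (DecidableEquality)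
open import Relation.Binary.PropositionalEquality
open import Relation.Nullary using (¬_; Dec; yes; no; does; contradiction; ¬?; _×-dec_)
open import Relation.Nullary.Decidable using (dec⇒maybe)
open import Relation.Unary using (Pred; Decidable)
open import Tactic.RingSolver using (solve-∀)
open import Tactic.RingSolver.Core.AlmostCommutativeRing using (AlmostCommutativeRing; fromCommutativeRing)

-- Naturals as rationals

-- When a box of content c is added below a first row of length a, one hook of that row grows, from
-- a - c to a + 1 - c; this is the factor 1 - 1/(a+1-c). The mass of the new first row is a product
-- over all lower rows, so its equality with the lost mass Σ weight/(a+1-c) needs an argument: it is
-- the partial fraction expansion of that product, with the contents of the addable boxes as poles
-- and the transition weights as residues. It is proved for every admissible row length, because the
-- induction uses it at two lengths. The moments then need only the relation (a+1-c)·u = 1 for u =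
-- 1/(a+1-c). The set of addable boxes varies with the partition. The weights are therefore defined
-- by recursion for every row and vanish by themselves where no box fits; sums run over all rows,
-- and the link to quotients of hook products is made separately. On the tableau side, deleting a
-- cell shifts positions in a word of entries, so the entries are read as a function on cells.

ring : AlmostCommutativeRing 0ℓ 0ℓ
ring = fromCommutativeRing ℚ.+-*-commutativeRing (λ x → dec⇒maybe (0ℚ ℚ.≟ x))

-- `_/_` normalises by a gcd that is stuck on variables; on unnormalised fractions the identity is
-- plain integer arithmetic.
ℕ→ℚ-+ : ∀ m n → ℕ→ℚ (m ℕ.+ n) ≡ ℕ→ℚ m + ℕ→ℚ n
ℕ→ℚ-+ m n = ℚ.toℚᵘ-injective (begin-equality
  toℚᵘ (ℕ→ℚ (m ℕ.+ n))             ≃⟨ ℚ.toℚᵘ-fromℚᵘ (mkℚᵘ (ℤ.+ (m ℕ.+ n)) 0) ⟩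
  mkℚᵘ (ℤ.+ (m ℕ.+ n)) 0           ≃⟨ *≡* (cong (ℤ._* ℤ.1ℤ) (sym (cong₂ ℤ._+_ (ℤ.*-identityʳ (ℤ.+ m)) (ℤ.*-identityʳ (ℤ.+ n))))) ⟩
  mkℚᵘ (ℤ.+ m) 0 ℚᵘ.+ mkℚᵘ (ℤ.+ n) 0 ≃⟨ ℚᵘ.+-cong (ℚ.toℚᵘ-fromℚᵘ (mkℚᵘ (ℤ.+ m) 0)) (ℚ.toℚᵘ-fromℚᵘ (mkℚᵘ (ℤ.+ n) 0)) ⟨
  toℚᵘ (ℕ→ℚ m) ℚᵘ.+ toℚᵘ (ℕ→ℚ n)   ≃⟨ ℚ.toℚᵘ-homo-+ (ℕ→ℚ m) (ℕ→ℚ n) ⟨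
  toℚᵘ (ℕ→ℚ m + ℕ→ℚ n)             ∎)
  where open ℚᵘ.≤-Reasoning

/-* : ∀ a b c d .{{_ : ℕ.NonZero b}} .{{_ : ℕ.NonZero d}} .{{_ : ℕ.NonZero (b ℕ.* d)}} →
  (ℤ.+ a / b) * (ℤ.+ c / d) ≡ ℤ.+ (a ℕ.* c) / (b ℕ.* d)
/-* a (suc b) c (suc d) = ℚ.toℚᵘ-injective (begin-equality
  toℚᵘ ((ℤ.+ a / suc b) * (ℤ.+ c / suc d)) ≃⟨ ℚ.toℚᵘ-homo-* (ℤ.+ a / suc b) (ℤ.+ c / suc d) ⟩
  toℚᵘ (ℤ.+ a / suc b) ℚᵘ.* toℚᵘ (ℤ.+ c / suc d) ≃⟨ ℚᵘ.*-cong (ℚ.toℚᵘ-fromℚᵘ (mkℚᵘ (ℤ.+ a) b)) (ℚ.toℚᵘ-fromℚᵘ (mkℚᵘ (ℤ.+ c) d)) ⟩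
  mkℚᵘ (ℤ.+ a) b ℚᵘ.* mkℚᵘ (ℤ.+ c) d ≃⟨ ℚᵘ.≃-reflexive (cong (λ z → mkℚᵘ z (d ℕ.+ b ℕ.* suc d)) (sym (ℤ.pos-* a c))) ⟩
  mkℚᵘ (ℤ.+ (a ℕ.* c)) (d ℕ.+ b ℕ.* suc d) ≃⟨ ℚ.toℚᵘ-fromℚᵘ (mkℚᵘ (ℤ.+ (a ℕ.* c)) (d ℕ.+ b ℕ.* suc d)) ⟨
  toℚᵘ (ℤ.+ (a ℕ.* c) / (suc b ℕ.* suc d)) ∎)
  where open ℚᵘ.≤-Reasoning

open ≡-Reasoning

ℕ→ℚ-* : ∀ m n → ℕ→ℚ (m ℕ.* n) ≡ ℕ→ℚ m * ℕ→ℚ n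
ℕ→ℚ-* m n = sym (/-* m 1 n 1)

ℕ→ℚ-suc : ∀ n → ℕ→ℚ (suc n) ≡ 1ℚ + ℕ→ℚ n
ℕ→ℚ-suc = ℕ→ℚ-+ 1

recip : ∀ n .{{_ : ℕ.NonZero n}} → ℚ
recip n = ℤ.+ 1 / n

/≡*recip : ∀ a b .{{_ : ℕ.NonZero b}} → ℤ.+ a / b ≡ ℕ→ℚ a * recip b
/≡*recip a b@(suc _) = begin
  ℤ.+ a / b                     ≡⟨ ℚ./-cong (cong ℤ.+_ (sym (ℕ.*-identityʳ a))) (sym (ℕ.*-identityˡ b)) ⟩
  ℤ.+ (a ℕ.* 1) / (1 ℕ.* b)     ≡⟨ /-* a 1 1 b ⟨
  ℕ→ℚ a * recip b ∎

*-recip : ∀ n .{{_ : ℕ.NonZero n}} → ℕ→ℚ n * recip n ≡ 1ℚ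
*-recip n@(suc m) = begin
  ℕ→ℚ n * recip n ≡⟨ /≡*recip n n ⟨
  ℤ.+ n / n       ≡⟨ ℚ.fromℚᵘ-cong {mkℚᵘ (ℤ.+ n) m} {ℚᵘ.1ℚᵘ} (*≡* (ℤ.*-comm (ℤ.+ n) ℤ.1ℤ)) ⟩
  1ℚ ∎

-- Every denominator here is a hook length, arm + leg + 1, or a content difference plus one; the
-- shift by one avoids all `NonZero` obligations.
inv : ℕ → ℚ
inv n = recip (suc n)

*-inv : ∀ n → (1ℚ + ℕ→ℚ n) * inv n ≡ 1ℚ
*-inv n = trans (cong (_* inv n) (sym (ℕ→ℚ-suc n))) (*-recip (suc n))

ℕ→ℚ-∸ : ∀ {m n} → m ≤ n → ℕ→ℚ (n ∸ m) ≡ ℕ→ℚ n - ℕ→ℚ m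
ℕ→ℚ-∸ {m} {n} m≤n = begin
  ℕ→ℚ (n ∸ m)                     ≡⟨ lem _ _ ⟩
  ℕ→ℚ (n ∸ m) + ℕ→ℚ m - ℕ→ℚ m     ≡⟨ cong (_- ℕ→ℚ m) (ℕ→ℚ-+ (n ∸ m) m) ⟨
  ℕ→ℚ (n ∸ m ℕ.+ m) - ℕ→ℚ m       ≡⟨ cong (λ z → ℕ→ℚ z - ℕ→ℚ m) (ℕ.m∸n+n≡m m≤n) ⟩
  ℕ→ℚ n - ℕ→ℚ m ∎
  where
  lem : ∀ a b → a ≡ a + b - b
  lem = solve-∀ ring

-- Sums over the rows 0, …, length μ, the last one being the empty row below μ.
Σrows : List ℕ → (ℕ → ℚ) → ℚ
Σrows []       f = f 0
Σrows (_ ∷ as) f = f 0 + Σrows as (f ∘ suc)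

Σrows-cong : ∀ μ {f g : ℕ → ℚ} → (∀ i → i ≤ length μ → f i ≡ g i) → Σrows μ f ≡ Σrows μ g
Σrows-cong []       eq = eq 0 z≤n
Σrows-cong (_ ∷ as) eq = cong₂ _+_ (eq 0 z≤n) (Σrows-cong as (λ i i≤n → eq (suc i) (s≤s i≤n)))

Σrows-+ : ∀ μ (f g : ℕ → ℚ) → Σrows μ (λ i → f i + g i) ≡ Σrows μ f + Σrows μ g
Σrows-+ []       f g = refl
Σrows-+ (_ ∷ as) f g = trans (cong (f 0 + g 0 +_) (Σrows-+ as (f ∘ suc) (g ∘ suc)))
                             (lem (f 0) (g 0) (Σrows as (f ∘ suc)) (Σrows as (g ∘ suc)))
  where
  lem : ∀ a b c d → (a + b) + (c + d) ≡ (a + c) + (b + d)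
  lem = solve-∀ ring

Σrows-*ˡ : ∀ μ c (f : ℕ → ℚ) → Σrows μ (λ i → c * f i) ≡ c * Σrows μ f
Σrows-*ˡ []       c f = refl
Σrows-*ˡ (_ ∷ as) c f = trans (cong (c * f 0 +_) (Σrows-*ˡ as c (f ∘ suc))) (sym (ℚ.*-distribˡ-+ c (f 0) _))

-- Transition weights and their moments

Decreasing : List ℕ → Set
Decreasing = Linked (λ a b → b ≤ a)

decreasing-head : ∀ {a as} → Decreasing (a ∷ as) → row as 0 ≤ a
decreasing-head [-]        = z≤n
decreasing-head (b≤a ∷ _)  = b≤a

decreasing-cons : ∀ {a as} → row as 0 ≤ a → Decreasing as → Decreasing (a ∷ as)
decreasing-cons {as = []}    _   _ = [-]
decreasing-cons {as = _ ∷ _} b≤a d = b≤a ∷ d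

row-≤-head : ∀ {as} → Decreasing as → ∀ i → row as i ≤ row as 0
row-≤-head {[]}     _ _       = z≤n
row-≤-head {a ∷ as} _ zero    = ℕ.≤-refl
row-≤-head {a ∷ as} d (suc i) = ℕ.≤-trans (row-≤-head (Linked.tail d) i) (decreasing-head d)

-- Junk for i > length μ: the new box then goes to the first empty row.
inc : List ℕ → ℕ → List ℕ
inc []       _       = 1 ∷ []
inc (a ∷ as) zero    = suc a ∷ as
inc (a ∷ as) (suc i) = a ∷ inc as i

-- The ratio of the first-row hook products for first rows of lengths x and x + 1 on top of the
-- given partition, see rowHooks-lengthen.
firstRowWeight : List ℕ → ℕ → ℚ
firstRowWeight []       x = inv x
firstRowWeight (b ∷ bs) x = (1ℚ + inv (x ∸ b)) * firstRowWeight bs (suc x)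

-- H_μ / H_{inc μ i} if inc μ i is a partition, and 0 if it is not.
addWeight : List ℕ → ℕ → ℚ
addWeight []       _       = 1ℚ
addWeight (a ∷ as) zero    = firstRowWeight as a
addWeight (a ∷ as) (suc i) = (1ℚ - inv (a ℕ.+ i ∸ row as i)) * addWeight as i

-- The ring solver treats inverses as atoms. Each of the two reciprocals is therefore multiplied by
-- a 1 written as the other denominator times its inverse, and the difference d + 1 of the
-- denominators cancels against `inv d`.
inv-partialFractions : ∀ p d → inv p * inv (p ℕ.+ suc d) ≡ inv d * (inv p - inv (p ℕ.+ suc d))
inv-partialFractions p d = sym (begin
  D * (P - V)                                                     ≡⟨ l1 D P V ⟩
  D * (P * 1ℚ - V * 1ℚ)
    ≡⟨ cong₂ (λ y z → D * (P * y - V * z)) (sym (*-inv (p ℕ.+ suc d))) (sym (*-inv p)) ⟩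
  D * (P * ((1ℚ + ℕ→ℚ (p ℕ.+ suc d)) * V) - V * ((1ℚ + ℕ→ℚ p) * P))
    ≡⟨ cong (λ y → D * (P * ((1ℚ + y) * V) - V * ((1ℚ + ℕ→ℚ p) * P))) (trans (ℕ→ℚ-+ p (suc d)) (cong (ℕ→ℚ p +_) (ℕ→ℚ-suc d))) ⟩
  D * (P * ((1ℚ + (ℕ→ℚ p + (1ℚ + ℕ→ℚ d))) * V) - V * ((1ℚ + ℕ→ℚ p) * P))  ≡⟨ l2 D P V (ℕ→ℚ p) (ℕ→ℚ d) ⟩
  P * V * ((1ℚ + ℕ→ℚ d) * D)                                       ≡⟨ cong (P * V *_) (*-inv d) ⟩
  P * V * 1ℚ                                                      ≡⟨ ℚ.*-identityʳ (P * V) ⟩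
  P * V ∎)
  where
  P V D : ℚ
  P = inv p
  V = inv (p ℕ.+ suc d)
  D = inv d
  l1 : ∀ D P V → D * (P - V) ≡ D * (P * 1ℚ - V * 1ℚ)
  l1 = solve-∀ ring
  l2 : ∀ D P V p d → D * (P * ((1ℚ + (p + (1ℚ + d))) * V) - V * ((1ℚ + p) * P)) ≡ P * V * ((1ℚ + d) * D)
  l2 = solve-∀ ring

-- Brings the larger of two denominators into the form p + suc d that `inv-partialFractions`
-- expects, with d = x ∸ b the difference of the two row lengths.
∸-shift : ∀ {x b i r} → b ≤ x → r ≤ b → x ℕ.+ suc i ∸ r ≡ (b ℕ.+ i ∸ r) ℕ.+ suc (x ∸ b)
∸-shift {x} {b} {i} {r} b≤x r≤b = sym (begin
  (b ℕ.+ i ∸ r) ℕ.+ suc (x ∸ b)  ≡⟨ ℕ.+-∸-comm (suc (x ∸ b)) (ℕ.≤-trans r≤b (ℕ.m≤m+n b i)) ⟨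
  b ℕ.+ i ℕ.+ suc (x ∸ b) ∸ r    ≡⟨ cong (_∸ r) (begin
    b ℕ.+ i ℕ.+ suc (x ∸ b)      ≡⟨ ℕ.+-suc (b ℕ.+ i) (x ∸ b) ⟩
    suc (b ℕ.+ i ℕ.+ (x ∸ b))    ≡⟨ cong (λ z → suc (z ℕ.+ (x ∸ b))) (ℕ.+-comm b i) ⟩
    suc (i ℕ.+ b ℕ.+ (x ∸ b))    ≡⟨ cong suc (ℕ.+-assoc i b (x ∸ b)) ⟩
    suc (i ℕ.+ (b ℕ.+ (x ∸ b)))  ≡⟨ cong (λ z → suc (i ℕ.+ z)) (ℕ.m+[n∸m]≡n b≤x) ⟩
    suc i ℕ.+ x                  ≡⟨ ℕ.+-comm (suc i) x ⟩
    x ℕ.+ suc i                  ∎) ⟩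
  x ℕ.+ suc i ∸ r ∎)

-- This is the Cauchy transform of Kerov's transition measure at x + 1. Partial fractions split each
-- product `u i * v i`, so the tail enters through two sums: the one at `suc x` yields the claim,
-- and the one at `b` is the mass lost to row b, which cancels the term of row b itself.
firstRowWeight-expand : ∀ as x → Decreasing as → row as 0 ≤ x →
  firstRowWeight as x ≡ Σrows as (λ i → addWeight as i * inv (x ℕ.+ i ∸ row as i))
firstRowWeight-expand [] x _ _ = trans (cong inv (sym (ℕ.+-identityʳ x))) (sym (ℚ.*-identityˡ _))
firstRowWeight-expand (b ∷ bs) x dec b≤x = sym (begin
  firstRowWeight bs b * inv (x ℕ.+ 0 ∸ b) + Σrows bs (λ i → (1ℚ - u i) * addWeight bs i * inv (x ℕ.+ suc i ∸ row bs i))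
    ≡⟨ cong₂ _+_ (cong (λ z → firstRowWeight bs b * inv (z ∸ b)) (ℕ.+-identityʳ x)) (Σrows-cong bs term) ⟩
  firstRowWeight bs b * D + Σrows bs (λ i → (1ℚ + D) * (addWeight bs i * v i) + (- D) * (addWeight bs i * u i))
    ≡⟨ cong (firstRowWeight bs b * D +_) (trans (Σrows-+ bs _ _) (cong₂ _+_ (Σrows-*ˡ bs (1ℚ + D) _) (Σrows-*ˡ bs (- D) _))) ⟩
  firstRowWeight bs b * D + ((1ℚ + D) * Σrows bs (λ i → addWeight bs i * v i) + (- D) * Σrows bs (λ i → addWeight bs i * u i))
    ≡⟨ cong₂ (λ y z → firstRowWeight bs b * D + ((1ℚ + D) * y + (- D) * z))
         (firstRowWeight-expand bs (suc x) (Linked.tail dec) (ℕ.m≤n⇒m≤1+n (ℕ.≤-trans (decreasing-head dec) b≤x)))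
         (firstRowWeight-expand bs b (Linked.tail dec) (decreasing-head dec)) ⟨
  firstRowWeight bs b * D + ((1ℚ + D) * firstRowWeight bs (suc x) + (- D) * firstRowWeight bs b)
    ≡⟨ lem (firstRowWeight bs b) D (firstRowWeight bs (suc x)) ⟩
  (1ℚ + D) * firstRowWeight bs (suc x) ∎)
  where
  D : ℚ
  D = inv (x ∸ b)
  u v : ℕ → ℚ
  u i = inv (b ℕ.+ i ∸ row bs i)
  v i = inv (suc x ℕ.+ i ∸ row bs i)
  lem : ∀ p D y → p * D + ((1ℚ + D) * y + (- D) * p) ≡ (1ℚ + D) * y
  lem = solve-∀ ring
  l1 : ∀ u w v → (1ℚ - u) * w * v ≡ w * v - w * (u * v)
  l1 = solve-∀ ring
  l2 : ∀ u w v D → w * v - w * (D * (u - v)) ≡ (1ℚ + D) * (w * v) + (- D) * (w * u)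
  l2 = solve-∀ ring
  uv : ∀ i → u i * v i ≡ D * (u i - v i)
  uv i rewrite sym (ℕ.+-suc x i)
             | ∸-shift {x} {b} {i} {row bs i} b≤x (ℕ.≤-trans (row-≤-head (Linked.tail dec) i) (decreasing-head dec))
             = inv-partialFractions (b ℕ.+ i ∸ row bs i) (x ∸ b)
  term : ∀ i → i ≤ length bs → (1ℚ - u i) * addWeight bs i * inv (x ℕ.+ suc i ∸ row bs i)
                     ≡ (1ℚ + D) * (addWeight bs i * v i) + (- D) * (addWeight bs i * u i)
  term i _ = begin
    (1ℚ - u i) * addWeight bs i * inv (x ℕ.+ suc i ∸ row bs i) ≡⟨ cong (λ z → (1ℚ - u i) * addWeight bs i * inv (z ∸ row bs i)) (ℕ.+-suc x i) ⟩
    (1ℚ - u i) * addWeight bs i * v i                          ≡⟨ l1 (u i) (addWeight bs i) (v i) ⟩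
    addWeight bs i * v i - addWeight bs i * (u i * v i)                ≡⟨ cong (λ z → addWeight bs i * v i - addWeight bs i * z) (uv i) ⟩
    addWeight bs i * v i - addWeight bs i * (D * (u i - v i))          ≡⟨ l2 (u i) (addWeight bs i) (v i) D ⟩
    (1ℚ + D) * (addWeight bs i * v i) + (- D) * (addWeight bs i * u i) ∎

-- The content of the box that `inc μ i` would add, in column `row μ i`.
content : List ℕ → ℕ → ℚ
content μ i = ℕ→ℚ (row μ i) - ℕ→ℚ i

module _ (a : ℕ) (as : List ℕ) (dec : Decreasing (a ∷ as)) where
  private
    u : ℕ → ℚ
    u i = inv (a ℕ.+ i ∸ row as i)
    row-≤ : ∀ i → row as i ≤ a
    row-≤ i = ℕ.≤-trans (row-≤-head (Linked.tail dec) i) (decreasing-head dec)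
    -- Conservation of mass: the partial fraction expansion evaluated at the length of the row put
    -- on top.
    firstRow-sum : Σrows as (λ i → addWeight as i * u i) ≡ firstRowWeight as a
    firstRow-sum = sym (firstRowWeight-expand as a (Linked.tail dec) (decreasing-head dec))
    -- The only fact about `u` that the higher moments use; multiplied by a power of the content, it
    -- turns every product of `u` and a content into terms linear in `u`.
    u-inverse : ∀ i → (1ℚ + (ℕ→ℚ a - content as i)) * u i ≡ 1ℚ
    u-inverse i = trans (cong (λ z → (1ℚ + z) * u i) (sym (begin
      ℕ→ℚ (a ℕ.+ i ∸ row as i)         ≡⟨ ℕ→ℚ-∸ (ℕ.≤-trans (row-≤ i) (ℕ.m≤m+n a i)) ⟩
      ℕ→ℚ (a ℕ.+ i) - ℕ→ℚ (row as i)   ≡⟨ cong (_- ℕ→ℚ (row as i)) (ℕ→ℚ-+ a i) ⟩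
      ℕ→ℚ a + ℕ→ℚ i - ℕ→ℚ (row as i)   ≡⟨ l (ℕ→ℚ a) (ℕ→ℚ i) (ℕ→ℚ (row as i)) ⟩
      ℕ→ℚ a - content as i ∎)))
      (*-inv (a ℕ.+ i ∸ row as i))
      where
      l : ∀ a i r → a + i - r ≡ a - (r - i)
      l = solve-∀ ring
    content-suc : ∀ i → content (a ∷ as) (suc i) ≡ content as i - 1ℚ
    content-suc i = trans (cong (λ z → ℕ→ℚ (row as i) - z) (ℕ→ℚ-suc i)) (l (ℕ→ℚ (row as i)) (ℕ→ℚ i))
      where
      l : ∀ r i → r - (1ℚ + i) ≡ r - i - 1ℚ
      l = solve-∀ ring

  moment₀-cons : Σrows (a ∷ as) (addWeight (a ∷ as)) ≡ Σrows as (addWeight as)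
  moment₀-cons = begin
    firstRowWeight as a + Σrows as (λ i → (1ℚ - u i) * addWeight as i)
      ≡⟨ cong (firstRowWeight as a +_) (Σrows-cong as (λ i _ → l1 (u i) (addWeight as i))) ⟩
    firstRowWeight as a + Σrows as (λ i → addWeight as i + (- 1ℚ) * (addWeight as i * u i))
      ≡⟨ cong (firstRowWeight as a +_) (trans (Σrows-+ as _ _) (cong (Σrows as (addWeight as) +_) (trans (Σrows-*ˡ as (- 1ℚ) _) (cong (- 1ℚ *_) firstRow-sum)))) ⟩
    firstRowWeight as a + (Σrows as (addWeight as) + (- 1ℚ) * firstRowWeight as a)
      ≡⟨ l2 (firstRowWeight as a) (Σrows as (addWeight as)) ⟩
    Σrows as (addWeight as) ∎
    where
    l1 : ∀ u w → (1ℚ - u) * w ≡ w + (- 1ℚ) * (w * u)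
    l1 = solve-∀ ring
    l2 : ∀ p s → p + (s + (- 1ℚ) * p) ≡ s
    l2 = solve-∀ ring

  -- Contents drop by one under a new top row, and (1 + a - c)u = 1 gives (1 - u)(c - 1) = c - a·u.
  -- The loss, a times the lost mass, is what the new box of content a contributes.
  moment₁-cons : Σrows (a ∷ as) (λ i → addWeight (a ∷ as) i * content (a ∷ as) i) ≡ Σrows as (λ i → addWeight as i * content as i)
  moment₁-cons = begin
    firstRowWeight as a * (ℕ→ℚ a - 0ℚ) + Σrows as (λ i → (1ℚ - u i) * addWeight as i * content (a ∷ as) (suc i))
      ≡⟨ cong (firstRowWeight as a * (ℕ→ℚ a - 0ℚ) +_) (Σrows-cong as term) ⟩
    firstRowWeight as a * (ℕ→ℚ a - 0ℚ) + Σrows as (λ i → addWeight as i * content as i + (- ℕ→ℚ a) * (addWeight as i * u i))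
      ≡⟨ cong (firstRowWeight as a * (ℕ→ℚ a - 0ℚ) +_) (trans (Σrows-+ as _ _) (cong (S₁ +_) (trans (Σrows-*ˡ as (- ℕ→ℚ a) _) (cong (- ℕ→ℚ a *_) firstRow-sum)))) ⟩
    firstRowWeight as a * (ℕ→ℚ a - 0ℚ) + (S₁ + (- ℕ→ℚ a) * firstRowWeight as a)
      ≡⟨ l2 (firstRowWeight as a) (ℕ→ℚ a) S₁ ⟩
    S₁ ∎
    where
    S₁ : ℚ
    S₁ = Σrows as (λ i → addWeight as i * content as i)
    -- The product (1 + (a - c))·u is produced verbatim, so that `u-inverse` can replace it by 1
    -- before `l1′` finishes.
    l1 : ∀ u w c a → (1ℚ - u) * w * (c - 1ℚ) ≡ w * (c - 1ℚ) - w * (a * u - (1ℚ + (a - c)) * u)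
    l1 = solve-∀ ring
    l1′ : ∀ u w c a → w * (c - 1ℚ) - w * (a * u - 1ℚ) ≡ w * c + (- a) * (w * u)
    l1′ = solve-∀ ring
    l2 : ∀ p a s → p * (a - 0ℚ) + (s + (- a) * p) ≡ s
    l2 = solve-∀ ring
    term : ∀ i → i ≤ length as → (1ℚ - u i) * addWeight as i * content (a ∷ as) (suc i) ≡ addWeight as i * content as i + (- ℕ→ℚ a) * (addWeight as i * u i)
    term i _ = begin
      (1ℚ - u i) * addWeight as i * content (a ∷ as) (suc i) ≡⟨ cong ((1ℚ - u i) * addWeight as i *_) (content-suc i) ⟩
      (1ℚ - u i) * addWeight as i * (content as i - 1ℚ) ≡⟨ l1 (u i) (addWeight as i) (content as i) (ℕ→ℚ a) ⟩
      addWeight as i * (content as i - 1ℚ) - addWeight as i * (ℕ→ℚ a * u i - (1ℚ + (ℕ→ℚ a - content as i)) * u i)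
        ≡⟨ cong (λ z → addWeight as i * (content as i - 1ℚ) - addWeight as i * (ℕ→ℚ a * u i - z)) (u-inverse i) ⟩
      addWeight as i * (content as i - 1ℚ) - addWeight as i * (ℕ→ℚ a * u i - 1ℚ) ≡⟨ l1′ (u i) (addWeight as i) (content as i) (ℕ→ℚ a) ⟩
      addWeight as i * content as i + (- ℕ→ℚ a) * (addWeight as i * u i) ∎

  -- Here (1 - u)(c - 1)² = c² - c + a - a²·u. The last term cancels the new box of content a, and
  -- the constant a, weighted by total mass 1, later counts the boxes of the new row.
  moment₂-cons : Σrows (a ∷ as) (λ i → addWeight (a ∷ as) i * (content (a ∷ as) i * content (a ∷ as) i))
               ≡ Σrows as (λ i → addWeight as i * (content as i * content as i)) - Σrows as (λ i → addWeight as i * content as i) + ℕ→ℚ a * Σrows as (addWeight as)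
  moment₂-cons = begin
    firstRowWeight as a * ((A - 0ℚ) * (A - 0ℚ)) + Σrows as (λ i → (1ℚ - u i) * addWeight as i * (content (a ∷ as) (suc i) * content (a ∷ as) (suc i)))
      ≡⟨ cong (firstRowWeight as a * ((A - 0ℚ) * (A - 0ℚ)) +_) (Σrows-cong as term) ⟩
    firstRowWeight as a * ((A - 0ℚ) * (A - 0ℚ)) + Σrows as (λ i → f₂ i + ((- 1ℚ) * f₁ i + (A * addWeight as i + (- (A * A)) * (addWeight as i * u i))))
      ≡⟨ cong (firstRowWeight as a * ((A - 0ℚ) * (A - 0ℚ)) +_)
           (trans (Σrows-+ as _ _) (cong (Σrows as f₂ +_)
             (trans (Σrows-+ as _ _) (cong₂ _+_ (Σrows-*ˡ as (- 1ℚ) _)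
               (trans (Σrows-+ as _ _) (cong₂ _+_ (Σrows-*ˡ as A _)
                 (trans (Σrows-*ˡ as (- (A * A)) _) (cong (- (A * A) *_) firstRow-sum)))))))) ⟩
    firstRowWeight as a * ((A - 0ℚ) * (A - 0ℚ)) + (Σrows as f₂ + ((- 1ℚ) * Σrows as f₁ + (A * Σrows as (addWeight as) + (- (A * A)) * firstRowWeight as a)))
      ≡⟨ l2 (firstRowWeight as a) A (Σrows as f₂) (Σrows as f₁) (Σrows as (addWeight as)) ⟩
    Σrows as f₂ - Σrows as f₁ + A * Σrows as (addWeight as) ∎
    where
    A : ℚ
    A = ℕ→ℚ a
    f₁ f₂ : ℕ → ℚ
    f₁ i = addWeight as i * content as i
    f₂ i = addWeight as i * (content as i * content as i)
    l1 : ∀ u w c a → (1ℚ - u) * w * ((c - 1ℚ) * (c - 1ℚ)) ≡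
                     w * ((c - 1ℚ) * (c - 1ℚ)) - w * (a * (a * u - (1ℚ + (a - c)) * u) - (1ℚ + (a - c)) * u * (c - 1ℚ))
    l1 = solve-∀ ring
    l1′ : ∀ u w c a → w * ((c - 1ℚ) * (c - 1ℚ)) - w * (a * (a * u - 1ℚ) - 1ℚ * (c - 1ℚ))
                    ≡ w * (c * c) + ((- 1ℚ) * (w * c) + (a * w + (- (a * a)) * (w * u)))
    l1′ = solve-∀ ring
    l2 : ∀ p a s t r → p * ((a - 0ℚ) * (a - 0ℚ)) + (s + ((- 1ℚ) * t + (a * r + (- (a * a)) * p))) ≡ s - t + a * r
    l2 = solve-∀ ring
    term : ∀ i → i ≤ length as → (1ℚ - u i) * addWeight as i * (content (a ∷ as) (suc i) * content (a ∷ as) (suc i))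
                       ≡ f₂ i + ((- 1ℚ) * f₁ i + (A * addWeight as i + (- (A * A)) * (addWeight as i * u i)))
    term i _ = begin
      (1ℚ - u i) * addWeight as i * (content (a ∷ as) (suc i) * content (a ∷ as) (suc i))
        ≡⟨ cong (λ c → (1ℚ - u i) * addWeight as i * (c * c)) (content-suc i) ⟩
      (1ℚ - u i) * addWeight as i * ((content as i - 1ℚ) * (content as i - 1ℚ)) ≡⟨ l1 (u i) (addWeight as i) (content as i) A ⟩
      addWeight as i * ((content as i - 1ℚ) * (content as i - 1ℚ))
        - addWeight as i * (A * (A * u i - (1ℚ + (A - content as i)) * u i) - (1ℚ + (A - content as i)) * u i * (content as i - 1ℚ))
        ≡⟨ cong (λ z → addWeight as i * ((content as i - 1ℚ) * (content as i - 1ℚ))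
                       - addWeight as i * (A * (A * u i - z) - z * (content as i - 1ℚ))) (u-inverse i) ⟩
      addWeight as i * ((content as i - 1ℚ) * (content as i - 1ℚ)) - addWeight as i * (A * (A * u i - 1ℚ) - 1ℚ * (content as i - 1ℚ))
        ≡⟨ l1′ (u i) (addWeight as i) (content as i) A ⟩
      f₂ i + ((- 1ℚ) * f₁ i + (A * addWeight as i + (- (A * A)) * (addWeight as i * u i))) ∎

moment₀ : ∀ μ → Decreasing μ → Σrows μ (addWeight μ) ≡ 1ℚ
moment₀ []       _   = refl
moment₀ (a ∷ as) dec = trans (moment₀-cons a as dec) (moment₀ as (Linked.tail dec))

-- The only box addable to the empty diagram has content 0, and no new row changes the mean. It
-- removes the linear term from `moment₂-cons`.
moment₁ : ∀ μ → Decreasing μ → Σrows μ (λ i → addWeight μ i * content μ i) ≡ 0ℚ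
moment₁ []       _   = refl
moment₁ (a ∷ as) dec = trans (moment₁-cons a as dec) (moment₁ as (Linked.tail dec))

moment₂ : ∀ μ → Decreasing μ → Σrows μ (λ i → addWeight μ i * (content μ i * content μ i)) ≡ ℕ→ℚ (size μ)
moment₂ []       _   = refl
moment₂ (a ∷ as) dec = begin
  Σrows (a ∷ as) (λ i → addWeight (a ∷ as) i * (content (a ∷ as) i * content (a ∷ as) i)) ≡⟨ moment₂-cons a as dec ⟩
  Σrows as (λ i → addWeight as i * (content as i * content as i)) - Σrows as (λ i → addWeight as i * content as i) + ℕ→ℚ a * Σrows as (addWeight as)
    ≡⟨ cong₂ _+_ (cong₂ _-_ (moment₂ as d) (moment₁ as d)) (cong (ℕ→ℚ a *_) (moment₀ as d)) ⟩
  ℕ→ℚ (size as) - 0ℚ + ℕ→ℚ a * 1ℚ  ≡⟨ l (ℕ→ℚ (size as)) (ℕ→ℚ a) ⟩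
  ℕ→ℚ a + ℕ→ℚ (size as)            ≡⟨ ℕ→ℚ-+ a (size as) ⟨
  ℕ→ℚ (a ℕ.+ size as) ∎
  where
  d : Decreasing as
  d = Linked.tail dec
  l : ∀ s a → s - 0ℚ + a * 1ℚ ≡ a + s
  l = solve-∀ ring

-- Hook products

Π< : ℕ → (ℕ → ℕ) → ℕ
Π< zero    f = 1
Π< (suc n) f = f 0 ℕ.* Π< n (f ∘ suc)

Π<-cong : ∀ n {f g : ℕ → ℕ} → (∀ i → i < n → f i ≡ g i) → Π< n f ≡ Π< n g
Π<-cong zero    eq = refl
Π<-cong (suc n) eq = cong₂ ℕ._*_ (eq 0 (s≤s z≤n)) (Π<-cong n (λ i i<n → eq (suc i) (s≤s i<n)))

Π<-split : ∀ m n f → Π< (m ℕ.+ n) f ≡ Π< m f ℕ.* Π< n (λ i → f (m ℕ.+ i))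
Π<-split zero    n f = sym (ℕ.+-identityʳ _)
Π<-split (suc m) n f = trans (cong (f 0 ℕ.*_) (Π<-split m n (f ∘ suc))) (sym (ℕ.*-assoc (f 0) _ _))

product-applyUpTo : ∀ f n → product (applyUpTo f n) ≡ Π< n f
product-applyUpTo f zero    = refl
product-applyUpTo f (suc n) = cong (f 0 ℕ.*_) (product-applyUpTo (f ∘ suc) n)

<⇒<ᵇ≡true : ∀ {m n} → m < n → (m <ᵇ n) ≡ true
<⇒<ᵇ≡true {m} {n} m<n with m <ᵇ n | ℕ.<⇒<ᵇ m<n
... | true | _ = refl

≥⇒<ᵇ≡false : ∀ {m n} → n ≤ m → (m <ᵇ n) ≡ false
≥⇒<ᵇ≡false {m} {n} n≤m with m <ᵇ n in eq
... | false = refl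
... | true  = contradiction (ℕ.<ᵇ⇒< m n (subst T (sym eq) _)) (ℕ.≤⇒≯ n≤m)

col-cons : ∀ {b} bs {j} → j < b → col (b ∷ bs) j ≡ suc (col bs j)
col-cons {b} bs {j} j<b rewrite <⇒<ᵇ≡true j<b = refl

col-≥ : ∀ {as} → Decreasing as → ∀ {j} → row as 0 ≤ j → col as j ≡ 0
col-≥ {[]}     _   _   = refl
col-≥ {a ∷ as} dec a≤j rewrite ≥⇒<ᵇ≡false a≤j = col-≥ (Linked.tail dec) (ℕ.≤-trans (decreasing-head dec) a≤j)

-- The hook product of a first row of length x on top of the partition as.
rowHooks : ℕ → List ℕ → ℕ
rowHooks x as = Π< x (λ j → suc (x ∸ suc j ℕ.+ col as j))

m∸n≡1+[m∸1+n] : ∀ {m n} → n < m → m ∸ n ≡ suc (m ∸ suc n)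
m∸n≡1+[m∸1+n] {suc m} {n} (s≤s n≤m) = ℕ.+-∸-assoc 1 n≤m

-- Left of column b, dropping the row b shortens each leg by one while the extra box lengthens each
-- arm by one, so the hooks agree. Right of it all legs are 0, and the hooks are 1, ..., x - b on
-- one side and 1, ..., x - b + 1 on the other.
rowHooks-cons : ∀ {x b bs} → b ≤ x → Decreasing (b ∷ bs) →
  rowHooks x (b ∷ bs) ℕ.* suc (x ∸ b) ≡ rowHooks (suc x) bs
rowHooks-cons {x} {b} {bs} b≤x dec = subst (λ x → rowHooks x (b ∷ bs) ℕ.* suc (x ∸ b) ≡ rowHooks (suc x) bs)
                                       (ℕ.m+[n∸m]≡n b≤x) (shifted (x ∸ b))
  where
  shifted : ∀ d → rowHooks (b ℕ.+ d) (b ∷ bs) ℕ.* suc (b ℕ.+ d ∸ b) ≡ rowHooks (suc (b ℕ.+ d)) bs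
  shifted d = begin
    Π< (b ℕ.+ d) f ℕ.* suc (b ℕ.+ d ∸ b)                      ≡⟨ cong₂ ℕ._*_ (Π<-split b d f) (cong suc (ℕ.m+n∸m≡n b d)) ⟩
    Π< b f ℕ.* Π< d (λ e → f (b ℕ.+ e)) ℕ.* suc d             ≡⟨ ℕ.*-assoc (Π< b f) _ _ ⟩
    Π< b f ℕ.* (Π< d (λ e → f (b ℕ.+ e)) ℕ.* suc d)           ≡⟨ cong (Π< b f ℕ.*_) (ℕ.*-comm _ (suc d)) ⟩
    Π< b f ℕ.* (suc d ℕ.* Π< d (λ e → f (b ℕ.+ e)))           ≡⟨ cong₂ ℕ._*_ (Π<-cong b left) (cong (suc d ℕ.*_) (Π<-cong d right)) ⟩
    -- `suc d` is the hook at column b in the row that is longer by one; unfolding `Π< (suc d)` once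
    -- splits it off.
    Π< b g ℕ.* (suc d ℕ.* Π< d (λ e → suc (d ∸ suc e)))       ≡⟨ cong (Π< b g ℕ.*_) (Π<-cong (suc d) right′) ⟨
    Π< b g ℕ.* Π< (suc d) (λ e → g (b ℕ.+ e))                 ≡⟨ Π<-split b (suc d) g ⟨
    Π< (b ℕ.+ suc d) g                                        ≡⟨ cong (λ n → Π< n g) (ℕ.+-suc b d) ⟩
    Π< (suc (b ℕ.+ d)) g ∎
    where
    f g : ℕ → ℕ
    f j = suc (b ℕ.+ d ∸ suc j ℕ.+ col (b ∷ bs) j)
    g j = suc (suc (b ℕ.+ d) ∸ suc j ℕ.+ col bs j)
    left : ∀ j → j < b → f j ≡ g j
    left j j<b = cong suc (begin
      b ℕ.+ d ∸ suc j ℕ.+ col (b ∷ bs) j    ≡⟨ cong (b ℕ.+ d ∸ suc j ℕ.+_) (col-cons bs j<b) ⟩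
      b ℕ.+ d ∸ suc j ℕ.+ suc (col bs j)    ≡⟨ ℕ.+-suc _ _ ⟩
      suc (b ℕ.+ d ∸ suc j) ℕ.+ col bs j    ≡⟨ cong (ℕ._+ col bs j) (m∸n≡1+[m∸1+n] (ℕ.m≤n⇒m≤n+o d j<b)) ⟨
      b ℕ.+ d ∸ j ℕ.+ col bs j ∎)
    right : ∀ e → e < d → f (b ℕ.+ e) ≡ suc (d ∸ suc e)
    right e _ = cong suc (begin
      b ℕ.+ d ∸ suc (b ℕ.+ e) ℕ.+ col (b ∷ bs) (b ℕ.+ e) ≡⟨ cong (b ℕ.+ d ∸ suc (b ℕ.+ e) ℕ.+_) (col-≥ dec (ℕ.m≤m+n b e)) ⟩
      b ℕ.+ d ∸ suc (b ℕ.+ e) ℕ.+ 0                      ≡⟨ ℕ.+-identityʳ _ ⟩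
      b ℕ.+ d ∸ suc (b ℕ.+ e)                            ≡⟨ cong (b ℕ.+ d ∸_) (ℕ.+-suc b e) ⟨
      b ℕ.+ d ∸ (b ℕ.+ suc e)                            ≡⟨ ℕ.[m+n]∸[m+o]≡n∸o b d (suc e) ⟩
      d ∸ suc e ∎)
    right′ : ∀ e → e < suc d → g (b ℕ.+ e) ≡ suc (suc d ∸ suc e)
    right′ e _ = cong suc (begin
      b ℕ.+ d ∸ (b ℕ.+ e) ℕ.+ col bs (b ℕ.+ e)
        ≡⟨ cong (b ℕ.+ d ∸ (b ℕ.+ e) ℕ.+_) (col-≥ (Linked.tail dec) (ℕ.m≤n⇒m≤n+o e (decreasing-head dec))) ⟩
      b ℕ.+ d ∸ (b ℕ.+ e) ℕ.+ 0   ≡⟨ ℕ.+-identityʳ _ ⟩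
      b ℕ.+ d ∸ (b ℕ.+ e)         ≡⟨ ℕ.[m+n]∸[m+o]≡n∸o b d e ⟩
      d ∸ e ∎)

rowHooksℚ : ℕ → List ℕ → ℚ
rowHooksℚ x as = ℕ→ℚ (rowHooks x as)

rowHooksℚ-cons : ∀ {x b bs} → b ≤ x → Decreasing (b ∷ bs) →
  rowHooksℚ x (b ∷ bs) ≡ inv (x ∸ b) * rowHooksℚ (suc x) bs
rowHooksℚ-cons {x} {b} {bs} b≤x dec = sym (begin
  inv d * rowHooksℚ (suc x) bs                    ≡⟨ cong (λ z → inv d * ℕ→ℚ z) (rowHooks-cons b≤x dec) ⟨
  inv d * ℕ→ℚ (rowHooks x (b ∷ bs) ℕ.* suc d)     ≡⟨ cong (inv d *_) (trans (ℕ→ℚ-* (rowHooks x (b ∷ bs)) (suc d)) (cong (rowHooksℚ x (b ∷ bs) *_) (ℕ→ℚ-suc d))) ⟩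
  inv d * (rowHooksℚ x (b ∷ bs) * (1ℚ + ℕ→ℚ d))   ≡⟨ lem (inv d) (rowHooksℚ x (b ∷ bs)) (1ℚ + ℕ→ℚ d) ⟩
  rowHooksℚ x (b ∷ bs) * ((1ℚ + ℕ→ℚ d) * inv d)   ≡⟨ cong (rowHooksℚ x (b ∷ bs) *_) (*-inv d) ⟩
  rowHooksℚ x (b ∷ bs) * 1ℚ                       ≡⟨ ℚ.*-identityʳ _ ⟩
  rowHooksℚ x (b ∷ bs) ∎)
  where
  d : ℕ
  d = x ∸ b
  lem : ∀ a b c → a * (b * c) ≡ b * (c * a)
  lem = solve-∀ ring

-- The ratio (d+2)/(d+1) written as 1 + 1/(d+1), for a lengthened top row. Its reciprocal appears in
-- `inv-pred` as 1 - 1/(d+2), for a box added to a lower row.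
inv-suc : ∀ d → inv d ≡ (1ℚ + inv d) * inv (suc d)
inv-suc d = begin
  inv d                                         ≡⟨ ℚ.*-identityʳ (inv d) ⟨
  inv d * 1ℚ                                    ≡⟨ cong (inv d *_) (*-inv (suc d)) ⟨
  inv d * ((1ℚ + ℕ→ℚ (suc d)) * inv (suc d))    ≡⟨ cong (λ z → inv d * ((1ℚ + z) * inv (suc d))) (ℕ→ℚ-suc d) ⟩
  inv d * ((1ℚ + (1ℚ + ℕ→ℚ d)) * inv (suc d))   ≡⟨ l1 (inv d) (ℕ→ℚ d) (inv (suc d)) ⟩
  ((1ℚ + ℕ→ℚ d) * inv d + inv d) * inv (suc d)  ≡⟨ cong (λ z → (z + inv d) * inv (suc d)) (*-inv d) ⟩
  (1ℚ + inv d) * inv (suc d) ∎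
  where
  l1 : ∀ D q E → D * ((1ℚ + (1ℚ + q)) * E) ≡ ((1ℚ + q) * D + D) * E
  l1 = solve-∀ ring

inv-pred : ∀ d → inv (suc d) ≡ (1ℚ - inv (suc d)) * inv d
inv-pred d = begin
  inv (suc d)                                         ≡⟨ l1 (inv (suc d)) (inv d) ⟩
  inv (suc d) + inv d - inv d                         ≡⟨ cong (λ z → inv (suc d) + inv d - z) (inv-suc d) ⟩
  inv (suc d) + inv d - (1ℚ + inv d) * inv (suc d)    ≡⟨ l2 (inv (suc d)) (inv d) ⟩
  (1ℚ - inv (suc d)) * inv d ∎
  where
  l1 : ∀ a b → a ≡ a + b - b
  l1 = solve-∀ ring
  l2 : ∀ a b → a + b - (1ℚ + b) * a ≡ (1ℚ - a) * b
  l2 = solve-∀ ring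

-- Trading the row b for one more box on top, by `rowHooksℚ-cons`, leads to the tail. Its factor
-- changes from 1/(x-b+1) to 1/(x-b+2) as the top row grows, and that ratio is the factor of
-- `firstRowWeight`.
rowHooks-lengthen : ∀ as x → Decreasing as → row as 0 ≤ x → rowHooksℚ x as ≡ firstRowWeight as x * rowHooksℚ (suc x) as
rowHooks-lengthen [] x _ _ = sym (begin
  inv x * ℕ→ℚ (suc (x ℕ.+ 0) ℕ.* rowHooks x [])
    ≡⟨ cong (inv x *_) (trans (cong (λ z → ℕ→ℚ (suc z ℕ.* rowHooks x [])) (ℕ.+-identityʳ x))
         (trans (ℕ→ℚ-* (suc x) (rowHooks x [])) (cong (_* rowHooksℚ x []) (ℕ→ℚ-suc x)))) ⟩
  inv x * ((1ℚ + ℕ→ℚ x) * rowHooksℚ x [])   ≡⟨ lem (inv x) (1ℚ + ℕ→ℚ x) (rowHooksℚ x []) ⟩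
  (1ℚ + ℕ→ℚ x) * inv x * rowHooksℚ x []     ≡⟨ cong (_* rowHooksℚ x []) (*-inv x) ⟩
  1ℚ * rowHooksℚ x []                       ≡⟨ ℚ.*-identityˡ _ ⟩
  rowHooksℚ x [] ∎)
  where
  lem : ∀ a b c → a * (b * c) ≡ b * a * c
  lem = solve-∀ ring
rowHooks-lengthen (b ∷ bs) x dec b≤x = begin
  rowHooksℚ x (b ∷ bs)                                      ≡⟨ rowHooksℚ-cons b≤x dec ⟩
  inv d * rowHooksℚ (suc x) bs
    ≡⟨ cong₂ _*_ (inv-suc d) (rowHooks-lengthen bs (suc x) (Linked.tail dec) (ℕ.m≤n⇒m≤1+n (ℕ.≤-trans (decreasing-head dec) b≤x))) ⟩
  (1ℚ + inv d) * inv (suc d) * (firstRowWeight bs (suc x) * rowHooksℚ (suc (suc x)) bs)  ≡⟨ lem (1ℚ + inv d) (inv (suc d)) (firstRowWeight bs (suc x)) _ ⟩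
  firstRowWeight (b ∷ bs) x * (inv (suc d) * rowHooksℚ (suc (suc x)) bs)
    ≡⟨ cong (λ z → firstRowWeight (b ∷ bs) x * (inv z * rowHooksℚ (suc (suc x)) bs)) (ℕ.+-∸-assoc 1 b≤x) ⟨
  firstRowWeight (b ∷ bs) x * (inv (suc x ∸ b) * rowHooksℚ (suc (suc x)) bs)
    ≡⟨ cong (firstRowWeight (b ∷ bs) x *_) (rowHooksℚ-cons (ℕ.m≤n⇒m≤1+n b≤x) dec) ⟨
  firstRowWeight (b ∷ bs) x * rowHooksℚ (suc x) (b ∷ bs) ∎
  where
  d : ℕ
  d = x ∸ b
  lem : ∀ a b c d → a * b * (c * d) ≡ a * c * (b * d)
  lem = solve-∀ ring

-- In the row on top only the hook in column `row as i` changes. Exactly i boxes lie below it before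
-- the addition, so it grows from x + i - `row as i` by one. The proof reaches row i by peeling the
-- rows above it.
rowHooks-inc : ∀ as x i → i ≤ length as → Decreasing as → Decreasing (inc as i) → row (inc as i) 0 ≤ x →
  rowHooksℚ x as ≡ (1ℚ - inv (x ℕ.+ i ∸ row as i)) * rowHooksℚ x (inc as i)
rowHooks-inc [] (suc y) zero _ _ dec′ _ = begin
  rowHooksℚ x []                                  ≡⟨ rowHooks-lengthen [] x [] z≤n ⟩
  inv x * rowHooksℚ (suc x) []                    ≡⟨ cong (_* rowHooksℚ (suc x) []) (inv-pred y) ⟩
  (1ℚ - inv x) * inv y * rowHooksℚ (suc x) []     ≡⟨ ℚ.*-assoc (1ℚ - inv x) _ _ ⟩
  (1ℚ - inv x) * (inv y * rowHooksℚ (suc x) [])   ≡⟨ cong₂ (λ z t → (1ℚ - inv z) * t) (ℕ.+-identityʳ x) (rowHooksℚ-cons {x} {1} {[]} (s≤s z≤n) [-]) ⟨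
  (1ℚ - inv (x ℕ.+ 0)) * rowHooksℚ x (1 ∷ []) ∎
  where
  x : ℕ
  x = suc y
rowHooks-inc (b ∷ bs) x zero _ dec dec′ b<x = begin
  rowHooksℚ x (b ∷ bs)                            ≡⟨ rowHooksℚ-cons (ℕ.<⇒≤ b<x) dec ⟩
  inv (x ∸ b) * r                                 ≡⟨ cong (λ z → inv z * r) (m∸n≡1+[m∸1+n] b<x) ⟩
  inv (suc d) * r                                 ≡⟨ cong (_* r) (inv-pred d) ⟩
  (1ℚ - inv (suc d)) * inv d * r                  ≡⟨ ℚ.*-assoc (1ℚ - inv (suc d)) _ _ ⟩
  (1ℚ - inv (suc d)) * (inv d * r)
    ≡⟨ cong₂ (λ z t → (1ℚ - inv z) * t) (trans (cong (_∸ b) (ℕ.+-identityʳ x)) (m∸n≡1+[m∸1+n] b<x)) (rowHooksℚ-cons b<x dec′) ⟨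
  (1ℚ - inv (x ℕ.+ 0 ∸ b)) * rowHooksℚ x (suc b ∷ bs) ∎
  where
  d : ℕ
  d = x ∸ suc b
  r : ℚ
  r = rowHooksℚ (suc x) bs
rowHooks-inc (b ∷ bs) x (suc i) (s≤s i≤n) dec dec′ b≤x = begin
  rowHooksℚ x (b ∷ bs)             ≡⟨ rowHooksℚ-cons b≤x dec ⟩
  inv (x ∸ b) * rowHooksℚ (suc x) bs
    ≡⟨ cong (inv (x ∸ b) *_) (rowHooks-inc bs (suc x) i i≤n (Linked.tail dec) (Linked.tail dec′) (ℕ.m≤n⇒m≤1+n (ℕ.≤-trans (decreasing-head dec′) b≤x))) ⟩
  inv (x ∸ b) * (u * rowHooksℚ (suc x) (inc bs i))  ≡⟨ lem (inv (x ∸ b)) u _ ⟩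
  u * (inv (x ∸ b) * rowHooksℚ (suc x) (inc bs i))
    ≡⟨ cong₂ (λ z t → (1ℚ - inv (z ∸ row bs i)) * t) (ℕ.+-suc x i) (rowHooksℚ-cons b≤x dec′) ⟨
  (1ℚ - inv (x ℕ.+ suc i ∸ row bs i)) * rowHooksℚ x (b ∷ inc bs i) ∎
  where
  u : ℚ
  u = 1ℚ - inv (suc x ℕ.+ i ∸ row bs i)
  lem : ∀ a b c → a * (b * c) ≡ b * (a * c)
  lem = solve-∀ ring

shiftDown : Cell → Cell
shiftDown (i , j) = suc i , j

cellsFrom-suc : ∀ k as → cellsFrom (suc k) as ≡ map shiftDown (cellsFrom k as)
cellsFrom-suc k []       = refl
cellsFrom-suc k (a ∷ as) = trans (cong₂ _++_ (map-∘ (upTo a)) (cellsFrom-suc (suc k) as))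
                                 (sym (map-++ shiftDown (map (k ,_) (upTo a)) (cellsFrom (suc k) as)))

cellsFrom-cols : ∀ {x} k as → Decreasing as → row as 0 ≤ x → All (λ c → proj₂ c < x) (cellsFrom k as)
cellsFrom-cols k []       _   _   = []
cellsFrom-cols k (a ∷ as) dec a≤x = All.++⁺
  (All.map⁺ (All.applyUpTo⁺₁ id a (λ i<a → ℕ.≤-trans i<a a≤x)))
  (cellsFrom-cols (suc k) as (Linked.tail dec) (ℕ.≤-trans (decreasing-head dec) a≤x))

-- A row on top raises every row index by one and, left of column a, every column length by one, so
-- legs below are unchanged; `cellsFrom-cols` places all lower cells in those columns.
hookProduct-cons : ∀ a as → Decreasing (a ∷ as) → hookProduct (a ∷ as) ≡ rowHooks a as ℕ.* hookProduct as
hookProduct-cons a as dec = begin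
  product (map h (map (0 ,_) (upTo a) ++ cellsFrom 1 as))
    ≡⟨ cong product (map-++ h (map (0 ,_) (upTo a)) (cellsFrom 1 as)) ⟩
  product (map h (map (0 ,_) (upTo a)) ++ map h (cellsFrom 1 as))
    ≡⟨ product-++ (map h (map (0 ,_) (upTo a))) _ ⟩
  product (map h (map (0 ,_) (upTo a))) ℕ.* product (map h (cellsFrom 1 as))
    ≡⟨ cong₂ (λ xs ys → product xs ℕ.* product ys) first rest ⟩
  product (applyUpTo (λ j → h (0 , j)) a) ℕ.* hookProduct as
    ≡⟨ cong (ℕ._* hookProduct as) (trans (product-applyUpTo (λ j → h (0 , j)) a) (Π<-cong a firstHook)) ⟩
  rowHooks a as ℕ.* hookProduct as ∎
  where
  h : Cell → ℕ
  h = hook (a ∷ as)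
  first : map h (map (0 ,_) (upTo a)) ≡ applyUpTo (λ j → h (0 , j)) a
  first = trans (sym (map-∘ (upTo a))) (map-upTo _ a)
  firstHook : ∀ j → j < a → h (0 , j) ≡ suc (a ∸ suc j ℕ.+ col as j)
  firstHook j j<a = cong (λ z → suc (a ∸ suc j ℕ.+ (z ∸ 1))) (col-cons as j<a)
  rest : map h (cellsFrom 1 as) ≡ map (hook as) (cells as)
  rest = trans (cong (map h) (cellsFrom-suc 0 as)) (trans (sym (map-∘ (cells as)))
    (map-cong-local (All.map (λ {(i , j)} j<a → cong (λ z → suc (row as i ∸ suc j ℕ.+ (z ∸ suc (suc i)))) (col-cons as j<a))
                             (cellsFrom-cols 0 as (Linked.tail dec) (decreasing-head dec)))))

hookProductℚ : List ℕ → ℚ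
hookProductℚ μ = ℕ→ℚ (hookProduct μ)

hookProductℚ-cons : ∀ a as → Decreasing (a ∷ as) → hookProductℚ (a ∷ as) ≡ rowHooksℚ a as * hookProductℚ as
hookProductℚ-cons a as dec = trans (cong ℕ→ℚ (hookProduct-cons a as dec)) (ℕ→ℚ-* (rowHooks a as) (hookProduct as))

-- Justifies the recursion of `addWeight`. A box in the first row alters only first-row hooks; a
-- lower box alters one first-row hook and, independently, the hook product of the remaining
-- diagram.
hookProduct-inc : ∀ μ i → i ≤ length μ → Decreasing μ → Decreasing (inc μ i) →
  hookProductℚ μ ≡ addWeight μ i * hookProductℚ (inc μ i)
hookProduct-inc []       zero    _ _   _    = refl
hookProduct-inc (a ∷ as) zero    _ dec dec′ = begin
  hookProductℚ (a ∷ as)                               ≡⟨ hookProductℚ-cons a as dec ⟩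
  rowHooksℚ a as * hookProductℚ as                    ≡⟨ cong (_* hookProductℚ as) (rowHooks-lengthen as a (Linked.tail dec) (decreasing-head dec)) ⟩
  firstRowWeight as a * rowHooksℚ (suc a) as * hookProductℚ as     ≡⟨ ℚ.*-assoc (firstRowWeight as a) _ _ ⟩
  firstRowWeight as a * (rowHooksℚ (suc a) as * hookProductℚ as)   ≡⟨ cong (firstRowWeight as a *_) (hookProductℚ-cons (suc a) as dec′) ⟨
  firstRowWeight as a * hookProductℚ (suc a ∷ as) ∎
hookProduct-inc (a ∷ as) (suc i) (s≤s i≤n) dec dec′ = begin
  hookProductℚ (a ∷ as)              ≡⟨ hookProductℚ-cons a as dec ⟩
  rowHooksℚ a as * hookProductℚ as
    ≡⟨ cong₂ _*_ (rowHooks-inc as a i i≤n (Linked.tail dec) (Linked.tail dec′) (decreasing-head dec′))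
                 (hookProduct-inc as i i≤n (Linked.tail dec) (Linked.tail dec′)) ⟩
  u * rowHooksℚ a (inc as i) * (addWeight as i * hookProductℚ (inc as i))   ≡⟨ lem u _ (addWeight as i) _ ⟩
  u * addWeight as i * (rowHooksℚ a (inc as i) * hookProductℚ (inc as i))   ≡⟨ cong (u * addWeight as i *_) (hookProductℚ-cons a (inc as i) dec′) ⟨
  u * addWeight as i * hookProductℚ (a ∷ inc as i) ∎
  where
  u : ℚ
  u = 1ℚ - inv (a ℕ.+ i ∸ row as i)
  lem : ∀ a b c d → a * b * (c * d) ≡ a * c * (b * d)
  lem = solve-∀ ring

decreasing? : ∀ μ → Dec (Decreasing μ)
decreasing? = Linked.linked? (λ a b → b ℕ.≤? a)

-- If the box does not fit, the row above has the same length as row i, and peeling off that row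
-- produces the factor 1 - `inv 0` = 0. Hence summing over all rows is summing over the addable
-- boxes.
addWeight-nonaddable : ∀ μ i → i ≤ length μ → Decreasing μ → ¬ Decreasing (inc μ i) → addWeight μ i ≡ 0ℚ
addWeight-nonaddable []       zero    _ _   ¬dec′ = contradiction [-] ¬dec′
addWeight-nonaddable (a ∷ as) zero    _ dec ¬dec′ =
  contradiction (decreasing-cons (ℕ.m≤n⇒m≤1+n (decreasing-head dec)) (Linked.tail dec)) ¬dec′
addWeight-nonaddable (a ∷ as) (suc i) (s≤s i≤n) dec ¬dec′ with decreasing? (inc as i)
... | no ¬d = trans (cong ((1ℚ - inv (a ℕ.+ i ∸ row as i)) *_) (addWeight-nonaddable as i i≤n (Linked.tail dec) ¬d)) (ℚ.*-zeroʳ (1ℚ - inv (a ℕ.+ i ∸ row as i)))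
... | yes d = trans (cong (λ z → (1ℚ - inv z) * addWeight as i) (full as i i≤n (λ le → ¬dec′ (decreasing-cons le d)) (decreasing-head dec))) (ℚ.*-zeroˡ (addWeight as i))
  where
  full : ∀ as i → i ≤ length as → ¬ (row (inc as i) 0 ≤ a) → row as 0 ≤ a → a ℕ.+ i ∸ row as i ≡ 0
  full []       zero    _ ≰a _ = trans (ℕ.+-identityʳ a) (ℕ.n≤0⇒n≡0 (ℕ.≤-pred (ℕ.≰⇒> ≰a)))
  full (b ∷ bs) zero    _ ≰a _ = trans (cong (_∸ b) (ℕ.+-identityʳ a)) (ℕ.m≤n⇒m∸n≡0 (ℕ.≤-pred (ℕ.≰⇒> ≰a)))
  full (b ∷ bs) (suc i) _ ≰a ≤a = contradiction ≤a ≰a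

sum-cellsFrom-inc : ∀ (g : Cell → ℕ) k μ i → i ≤ length μ →
  sum (map g (cellsFrom k (inc μ i))) ≡ sum (map g (cellsFrom k μ)) ℕ.+ g (k ℕ.+ i , row μ i)
sum-cellsFrom-inc g k [] zero _ = trans (ℕ.+-identityʳ _) (cong (λ z → g (z , 0)) (sym (ℕ.+-identityʳ k)))
sum-cellsFrom-inc g k (a ∷ as) zero _ = trans (sum-row (suc a)) (trans (cong (ℕ._+ s) (last a)) (trans (swap (S a) (g (k ℕ.+ 0 , a)) s)
    (cong (ℕ._+ g (k ℕ.+ 0 , a)) (sym (sum-row a)))))
  where
  S : ℕ → ℕ
  S x = sum (map g (map (k ,_) (upTo x)))
  s : ℕ
  s = sum (map g (cellsFrom (suc k) as))
  sum-row : ∀ x → sum (map g (cellsFrom k (x ∷ as))) ≡ S x ℕ.+ s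
  sum-row x = trans (cong sum (map-++ g (map (k ,_) (upTo x)) (cellsFrom (suc k) as))) (sum-++ (map g (map (k ,_) (upTo x))) _)
  last : ∀ a → S (suc a) ≡ S a ℕ.+ g (k ℕ.+ 0 , a)
  last a = begin
    S (suc a)                                              ≡⟨ cong (λ xs → sum (map g (map (k ,_) xs))) (upTo-∷ʳ a) ⟨
    sum (map g (map (k ,_) (upTo a ++ a ∷ [])))            ≡⟨ cong (λ xs → sum (map g xs)) (map-++ (k ,_) (upTo a) _) ⟩
    sum (map g (map (k ,_) (upTo a) ++ (k , a) ∷ []))      ≡⟨ cong sum (map-++ g (map (k ,_) (upTo a)) _) ⟩
    sum (map g (map (k ,_) (upTo a)) ++ g (k , a) ∷ [])    ≡⟨ sum-++ (map g (map (k ,_) (upTo a))) _ ⟩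
    S a ℕ.+ (g (k , a) ℕ.+ 0)                              ≡⟨ cong (S a ℕ.+_) (ℕ.+-identityʳ _) ⟩
    S a ℕ.+ g (k , a)                                      ≡⟨ cong (λ z → S a ℕ.+ g (z , a)) (ℕ.+-identityʳ k) ⟨
    S a ℕ.+ g (k ℕ.+ 0 , a) ∎
  swap : ∀ a b c → a ℕ.+ b ℕ.+ c ≡ a ℕ.+ c ℕ.+ b
  swap a b c = trans (ℕ.+-assoc a b c) (trans (cong (a ℕ.+_) (ℕ.+-comm b c)) (sym (ℕ.+-assoc a c b)))
sum-cellsFrom-inc g k (a ∷ as) (suc i) (s≤s i≤n) = begin
  sum (map g (R ++ cellsFrom (suc k) (inc as i)))                  ≡⟨ split (cellsFrom (suc k) (inc as i)) ⟩
  sum (map g R) ℕ.+ sum (map g (cellsFrom (suc k) (inc as i)))     ≡⟨ cong (sum (map g R) ℕ.+_) (sum-cellsFrom-inc g (suc k) as i i≤n) ⟩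
  sum (map g R) ℕ.+ (sum (map g (cellsFrom (suc k) as)) ℕ.+ g (suc k ℕ.+ i , row as i)) ≡⟨ ℕ.+-assoc (sum (map g R)) _ _ ⟨
  sum (map g R) ℕ.+ sum (map g (cellsFrom (suc k) as)) ℕ.+ g (suc k ℕ.+ i , row as i)
    ≡⟨ cong₂ (λ x z → x ℕ.+ g (z , row as i)) (split (cellsFrom (suc k) as)) (ℕ.+-suc k i) ⟨
  sum (map g (R ++ cellsFrom (suc k) as)) ℕ.+ g (k ℕ.+ suc i , row as i) ∎
  where
  R : List Cell
  R = map (k ,_) (upTo a)
  split : ∀ xs → sum (map g (R ++ xs)) ≡ sum (map g R) ℕ.+ sum (map g xs)
  split xs = trans (cong sum (map-++ g R xs)) (sum-++ (map g R) (map g xs))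

-- Linear extensions of the adjacency relation on a list of cells

module _ {A B : Set} where

  map-unique-local : ∀ {f : A → B} {xs} → Unique xs → (∀ {x y} → x ∈ xs → y ∈ xs → f x ≡ f y → x ≡ y) → Unique (map f xs)
  map-unique-local {xs = []}     []       inj = []
  map-unique-local {xs = x ∷ xs} (x∉ ∷ u) inj =
    All.map⁺ (All.tabulate (λ y∈ eq → All.lookup x∉ y∈ (inj (here refl) (there y∈) eq)))
    ∷ map-unique-local u (λ x∈ y∈ → inj (there x∈) (there y∈))

  map-unique⁻ : ∀ {f : A → B} {xs x y} → Unique (map f xs) → x ∈ xs → y ∈ xs → f x ≡ f y → x ≡ y
  map-unique⁻ (_  ∷ _) (here refl) (here refl) _  = refl
  map-unique⁻ {f} (n  ∷ _) (here refl) (there y∈)  eq = contradiction eq (All.lookup n (∈-map⁺ f y∈))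
  map-unique⁻ {f} (n  ∷ _) (there x∈)  (here refl) eq = contradiction (sym eq) (All.lookup n (∈-map⁺ f x∈))
  map-unique⁻ (_  ∷ u) (there x∈)  (there y∈)  eq = map-unique⁻ u x∈ y∈ eq

  map-≗-local⁻ : ∀ {f g : A → B} {xs x} → map f xs ≡ map g xs → x ∈ xs → f x ≡ g x
  map-≗-local⁻ {xs = _ ∷ _} eq (here refl) = ∷-injectiveˡ eq
  map-≗-local⁻ {xs = _ ∷ _} eq (there x∈)  = map-≗-local⁻ (∷-injectiveʳ eq) x∈

  map-cong-∈ : ∀ {f g : A → B} {xs} → (∀ {x} → x ∈ xs → f x ≡ g x) → map f xs ≡ map g xs
  map-cong-∈ eq = map-cong-local (All.tabulate eq)

  concatMap-unique : ∀ (f : A → List B) {xs} → Unique xs → (∀ {x} → x ∈ xs → Unique (f x)) →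
    (∀ {x y z} → x ∈ xs → y ∈ xs → z ∈ f x → z ∈ f y → x ≡ y) → Unique (concatMap f xs)
  concatMap-unique f {[]}     []       _ _    = []
  concatMap-unique f {x ∷ xs} (x∉ ∷ u) h disj = Unique.++⁺ (h (here refl))
    (concatMap-unique f u (h ∘ there) (λ y∈ z∈ → disj (there y∈) (there z∈)))
    (λ (v∈fx , v∈) → let (y , y∈ , v∈fy) = find (∈-concatMap⁻ f {xs = xs} v∈) in
      All.lookup x∉ y∈ (disj (here refl) (there y∈) v∈fx v∈fy))

  length-concatMap : ∀ (f : A → List B) xs → length (concatMap f xs) ≡ sum (map (length ∘ f) xs)
  length-concatMap f []       = refl
  length-concatMap f (x ∷ xs) = trans (length-++ (f x)) (cong (length (f x) ℕ.+_) (length-concatMap f xs))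

-- The pigeonhole principle, which supplies the entry 1 in `smallest`.
unique-⊆-length : ∀ {A : Set} {xs ys : List A} → Unique xs → (∀ {x} → x ∈ xs → x ∈ ys) → length xs ≤ length ys
unique-⊆-length {xs = []}     _        _ = z≤n
unique-⊆-length {xs = x ∷ xs} (x∉ ∷ u) h with ∈-∃++ (h (here refl))
... | as , bs , refl = ℕ.≤-trans (s≤s (unique-⊆-length u rest))
        (ℕ.≤-reflexive (sym (trans (length-++ as) (trans (ℕ.+-suc _ _) (cong suc (sym (length-++ as)))))))
  where
  rest : ∀ {y} → y ∈ xs → y ∈ as ++ bs
  rest y∈ with ∈-++⁻ as (h (there y∈))
  ... | inj₁ y∈as         = ∈-++⁺ˡ y∈as
  ... | inj₂ (here refl)  = contradiction refl (All.lookup x∉ y∈)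
  ... | inj₂ (there y∈bs) = ∈-++⁺ʳ as y∈bs

-- Fillings as words and as labellings of cells

words-unique : ∀ k {A} → Unique A → Unique (words k A)
words-unique zero    _ = [] ∷ []
words-unique (suc k) u = concatMap-unique _ u
  (λ _ → Unique.map⁺ ∷-injectiveʳ (words-unique k u))
  (λ {a} {b} _ _ z∈a z∈b → let (_ , _ , p) = ∈-map⁻ (a ∷_) z∈a ; (_ , _ , q) = ∈-map⁻ (b ∷_) z∈b in
    ∷-injectiveˡ (trans (sym p) q))

∈-words⁻ : ∀ k {A v} → v ∈ words k A → length v ≡ k × All (_∈ A) v
∈-words⁻ zero    (here refl) = refl , []
∈-words⁻ (suc k) {A} v∈ with find (∈-concatMap⁻ (λ a → map (a ∷_) (words k A)) {xs = A} v∈)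
... | a , a∈ , v∈′ with ∈-map⁻ (a ∷_) v∈′
...   | v′ , v′∈ , refl with ∈-words⁻ k v′∈
...     | eq , all = cong suc eq , a∈ ∷ all

∈-words⁺ : ∀ {A v} → All (_∈ A) v → v ∈ words (length v) A
∈-words⁺ []         = here refl
∈-words⁺ {A} {a ∷ v} (a∈ ∷ all) = ∈-concatMap⁺ (λ a → map (a ∷_) (words (length v) A)) (lose a∈ (∈-map⁺ (a ∷_) (∈-words⁺ all)))

elemᵇ⇔∈ : ∀ {x} ys → T (elemᵇ x ys) ⇔ x ∈ ys
elemᵇ⇔∈ []       = mk⇔ (λ ()) (λ ())
elemᵇ⇔∈ {x} (y ∷ ys) with x ≡ᵇ y in eq
... | true  = mk⇔ (λ _ → here (ℕ.≡ᵇ⇒≡ x y (subst T (sym eq) _))) (λ _ → tt)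
... | false = mk⇔ (there ∘ to (elemᵇ⇔∈ ys))
                  (λ { (here refl) → contradiction (ℕ.≡⇒≡ᵇ x x refl) (subst T eq) ; (there x∈) → from (elemᵇ⇔∈ ys) x∈ })

distinctᵇ⇒unique : ∀ xs → T (distinctᵇ xs) → Unique xs
distinctᵇ⇒unique []       _ = []
distinctᵇ⇒unique (x ∷ xs) t with elemᵇ x xs in eq
... | false = All.tabulate (λ y∈ x≡y → subst T eq (from (elemᵇ⇔∈ xs) (subst (_∈ xs) (sym x≡y) y∈))) ∷ distinctᵇ⇒unique xs t

unique⇒distinctᵇ : ∀ {xs} → Unique xs → T (distinctᵇ xs)
unique⇒distinctᵇ []       = tt
unique⇒distinctᵇ {x ∷ xs} (x∉ ∷ u) with elemᵇ x xs in eq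
... | false = unique⇒distinctᵇ u
... | true  = contradiction refl (All.lookup x∉ (to (elemᵇ⇔∈ xs) (subst T (sym eq) tt)))

allᵇ⇔All : ∀ {A : Set} (p : A → Bool) xs → T (allᵇ p xs) ⇔ All (T ∘ p) xs
allᵇ⇔All p []       = mk⇔ (λ _ → []) (λ _ → tt)
allᵇ⇔All p (x ∷ xs) = mk⇔
  (λ t → let (px , pxs) = to T-∧ t in px ∷ to (allᵇ⇔All p xs) pxs)
  (λ { (px ∷ pxs) → from T-∧ (px , from (allᵇ⇔All p xs) pxs) })

zip-map-self : ∀ {A B : Set} (f : A → B) xs → zip xs (map f xs) ≡ map (λ x → x , f x) xs
zip-map-self f []       = refl
zip-map-self f (x ∷ xs) = cong ((x , f x) ∷_) (zip-map-self f xs)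

infix 4 _≟ᶜ_
_≟ᶜ_ : DecidableEquality Cell
_≟ᶜ_ = ≡-dec ℕ._≟_ ℕ._≟_

delete : Cell → List Cell → List Cell
delete c = filter (λ d → ¬? (d ≟ᶜ c))

length-delete : ∀ {c cs} → Unique cs → c ∈ cs → length cs ≡ suc (length (delete c cs))
length-delete {c} {cs = .c ∷ cs} (c∉ ∷ u) (here refl) = cong (suc ∘ length) (sym (begin
  delete c (c ∷ cs) ≡⟨ filter-reject (λ d → ¬? (d ≟ᶜ c)) {c} {cs} (λ c≢c → c≢c refl) ⟩
  delete c cs       ≡⟨ filter-all (λ d → ¬? (d ≟ᶜ c)) (All.map (λ c≢d d≡c → c≢d (sym d≡c)) c∉) ⟩
  cs ∎))
length-delete {c} {d ∷ cs} (d∉ ∷ u) (there c∈) = cong suc (trans (length-delete u c∈)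
  (sym (cong length (filter-accept (λ d → ¬? (d ≟ᶜ c)) {d} {cs} (All.lookup d∉ c∈)))))

-- At `skewCells la mu` its length is `numSYT la mu` by definition. Arbitrary lists of cells are
-- allowed so that a single cell can be deleted.
linearExtensions : List Cell → List (List ℕ)
linearExtensions cs = filterᵇ (isSYTᵇ cs) (words (length cs) (applyUpTo suc (length cs)))

-- Stated for functions because deleting a cell leaves the values at the other cells in place.
-- Values off `cs` are unconstrained, and that all labels occur follows by counting.
record IsLinearExtension (cs : List Cell) (τ : Cell → ℕ) : Set where
  field
    positive  : ∀ {c} → c ∈ cs → 1 ≤ τ c
    bounded   : ∀ {c} → c ∈ cs → τ c ≤ length cs
    injective : ∀ {c d} → c ∈ cs → d ∈ cs → τ c ≡ τ d → c ≡ d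
    monotone  : ∀ {c d} → c ∈ cs → d ∈ cs → T (adjacentᵇ c d) → τ c < τ d
open IsLinearExtension

valueAt : List Cell → List ℕ → Cell → ℕ
valueAt (c ∷ cs) (v ∷ vs) d = if does (d ≟ᶜ c) then v else valueAt cs vs d
valueAt _        _        _ = 0

valueAt-map : ∀ (τ : Cell → ℕ) {cs c} → c ∈ cs → valueAt cs (map τ cs) c ≡ τ c
valueAt-map τ {d ∷ cs} {c} c∈ with c ≟ᶜ d
... | yes refl = refl
valueAt-map τ {d ∷ cs} {c} (here c≡d) | no c≢d = contradiction c≡d c≢d
valueAt-map τ {d ∷ cs} {c} (there c∈) | no c≢d = valueAt-map τ c∈

map-valueAt : ∀ {cs v} → Unique cs → length v ≡ length cs → map (valueAt cs v) cs ≡ v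
map-valueAt {[]}     {[]}    _        _  = refl
map-valueAt {c ∷ cs} {x ∷ v} (c∉ ∷ u) eq = cong₂ _∷_ first (trans (map-cong-∈ rest) (map-valueAt u (ℕ.suc-injective eq)))
  where
  first : valueAt (c ∷ cs) (x ∷ v) c ≡ x
  first with c ≟ᶜ c
  ... | yes _  = refl
  ... | no c≢c = contradiction refl c≢c
  rest : ∀ {d} → d ∈ cs → valueAt (c ∷ cs) (x ∷ v) d ≡ valueAt cs v d
  rest {d} d∈ with d ≟ᶜ c
  ... | yes refl = contradiction refl (All.lookup c∉ d∈)
  ... | no _     = refl

isSYTᵇ-map⇔ : ∀ cs (τ : Cell → ℕ) → T (isSYTᵇ cs (map τ cs)) ⇔
  (Unique (map τ cs) × (∀ {c d} → c ∈ cs → d ∈ cs → T (adjacentᵇ c d) → τ c < τ d))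
isSYTᵇ-map⇔ cs τ rewrite zip-map-self τ cs = mk⇔ ⇒ ⇐
  where
  cv : List (Cell × ℕ)
  cv = map (λ c → c , τ c) cs
  q : Cell × ℕ → Cell × ℕ → Bool
  q a b = if adjacentᵇ (proj₁ a) (proj₁ b) then proj₂ a <ᵇ proj₂ b else true
  ⇒ : T (distinctᵇ (map τ cs) ∧ allᵇ (λ a → allᵇ (q a) cv) cv) →
      Unique (map τ cs) × (∀ {c d} → c ∈ cs → d ∈ cs → T (adjacentᵇ c d) → τ c < τ d)
  ⇒ t = distinctᵇ⇒unique _ (proj₁ (to T-∧ t)) , mono
    where
    mono : ∀ {c d} → c ∈ cs → d ∈ cs → T (adjacentᵇ c d) → τ c < τ d
    mono {c} {d} c∈ d∈ adj
      with r ← All.lookup (to (allᵇ⇔All (q (c , τ c)) cv)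
                 (All.lookup (to (allᵇ⇔All (λ a → allᵇ (q a) cv) cv) (proj₂ (to (T-∧ {distinctᵇ (map τ cs)}) t))) (∈-map⁺ _ c∈))) (∈-map⁺ _ d∈)
      with true ← adjacentᵇ c d = ℕ.<ᵇ⇒< (τ c) (τ d) r
  ⇐ : Unique (map τ cs) × (∀ {c d} → c ∈ cs → d ∈ cs → T (adjacentᵇ c d) → τ c < τ d) →
      T (distinctᵇ (map τ cs) ∧ allᵇ (λ a → allᵇ (q a) cv) cv)
  ⇐ (u , mono) = from T-∧ (unique⇒distinctᵇ u ,
    from (allᵇ⇔All (λ a → allᵇ (q a) cv) cv) (All.map⁺ (All.tabulate (λ {c} c∈ →
      from (allᵇ⇔All (q (c , τ c)) cv) (All.map⁺ (All.tabulate (λ {d} d∈ → ok c d (mono c∈ d∈))))))))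
    where
    ok : ∀ c d → (T (adjacentᵇ c d) → τ c < τ d) → T (q (c , τ c) (d , τ d))
    ok c d h with adjacentᵇ c d
    ... | true  = ℕ.<⇒<ᵇ (h tt)
    ... | false = tt

∈-linearExtensions⁻ : ∀ {cs v} → Unique cs → v ∈ linearExtensions cs →
  map (valueAt cs v) cs ≡ v × IsLinearExtension cs (valueAt cs v)
∈-linearExtensions⁻ {cs} {v} u v∈ = eq , record
  { positive  = λ c∈ → proj₁ (range c∈)
  ; bounded   = λ c∈ → proj₂ (range c∈)
  ; injective = map-unique⁻ (proj₁ syt)
  ; monotone  = proj₂ syt
  }
  where
  v∈words : v ∈ words (length cs) (applyUpTo suc (length cs))
  v∈words = proj₁ (∈-filter⁻ (T? ∘ isSYTᵇ cs) {xs = words (length cs) (applyUpTo suc (length cs))} v∈)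
  τ : Cell → ℕ
  τ = valueAt cs v
  eq : map τ cs ≡ v
  eq = map-valueAt u (proj₁ (∈-words⁻ (length cs) v∈words))
  syt : Unique (map τ cs) × (∀ {c d} → c ∈ cs → d ∈ cs → T (adjacentᵇ c d) → τ c < τ d)
  syt = to (isSYTᵇ-map⇔ cs τ) (subst (T ∘ isSYTᵇ cs) (sym eq) (proj₂ (∈-filter⁻ (T? ∘ isSYTᵇ cs) {xs = words (length cs) (applyUpTo suc (length cs))} v∈)))
  range : ∀ {c} → c ∈ cs → 1 ≤ τ c × τ c ≤ length cs
  range {c} c∈ with ∈-applyUpTo⁻ suc (All.lookup (proj₂ (∈-words⁻ (length cs) v∈words)) (subst (τ c ∈_) eq (∈-map⁺ τ c∈)))
  ... | i , i<n , p rewrite p = s≤s z≤n , i<n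

∈-linearExtensions⁺ : ∀ {cs τ} → Unique cs → IsLinearExtension cs τ → map τ cs ∈ linearExtensions cs
∈-linearExtensions⁺ {cs} {τ} u le = ∈-filter⁺ (T? ∘ isSYTᵇ cs)
  (subst (λ k → map τ cs ∈ words k (applyUpTo suc (length cs))) (length-map τ cs)
    (∈-words⁺ (All.map⁺ (All.tabulate inRange))))
  (from (isSYTᵇ-map⇔ cs τ) (map-unique-local u (injective le) , monotone le))
  where
  inRange : ∀ {c} → c ∈ cs → τ c ∈ applyUpTo suc (length cs)
  inRange {c} c∈ with τ c | positive le c∈ | bounded le c∈
  ... | suc i | _ | i<n = ∈-applyUpTo⁺ suc i<n

linearExtensions-unique : ∀ cs → Unique (linearExtensions cs)
linearExtensions-unique cs = Unique.filter⁺ (T? ∘ isSYTᵇ cs)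
  (words-unique (length cs) (Unique.applyUpTo⁺₁ suc (length cs) (λ i<j _ → ℕ.<⇒≢ (s≤s i<j))))

-- Removing the smallest entry

Minimal : List Cell → Cell → Set
Minimal cs c = c ∈ cs × (∀ {d} → d ∈ cs → ¬ T (adjacentᵇ d c))

-- Undoes the removal of the smallest entry: the restored cell receives 1 and all other labels move
-- up.
prepend : Cell → (Cell → ℕ) → Cell → ℕ
prepend c τ d = if does (d ≟ᶜ c) then 1 else suc (τ d)

prepend-self : ∀ c τ → prepend c τ c ≡ 1
prepend-self c τ with c ≟ᶜ c
... | yes _  = refl
... | no c≢c = contradiction refl c≢c

prepend-other : ∀ {c d} τ → d ≢ c → prepend c τ d ≡ suc (τ d)
prepend-other {c} {d} τ d≢c with d ≟ᶜ c
... | yes d≡c = contradiction d≡c d≢c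
... | no _    = refl

module _ {cs : List Cell} (u : Unique cs) where

  ∈-delete⁺ : ∀ {c d} → d ∈ cs → d ≢ c → d ∈ delete c cs
  ∈-delete⁺ {c} = ∈-filter⁺ (λ d → ¬? (d ≟ᶜ c))

  ∈-delete⁻ : ∀ {c d} → d ∈ delete c cs → d ∈ cs × d ≢ c
  ∈-delete⁻ {c} = ∈-filter⁻ (λ d → ¬? (d ≟ᶜ c)) {xs = cs}

  delete-unique : ∀ c → Unique (delete c cs)
  delete-unique c = Unique.filter⁺ (λ d → ¬? (d ≟ᶜ c)) u

  prepend-isLinearExtension : ∀ {c τ} → Minimal cs c → IsLinearExtension (delete c cs) τ → IsLinearExtension cs (prepend c τ)
  prepend-isLinearExtension {c} {τ} (c∈ , min) le = record
    { positive = pos ; bounded = bnd ; injective = inj ; monotone = mono }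
    where
    pos : ∀ {d} → d ∈ cs → 1 ≤ prepend c τ d
    pos {d} d∈ with d ≟ᶜ c
    ... | yes _ = s≤s z≤n
    ... | no  _ = s≤s z≤n
    bnd : ∀ {d} → d ∈ cs → prepend c τ d ≤ length cs
    bnd {d} d∈ rewrite length-delete u c∈ with d ≟ᶜ c
    ... | yes _  = s≤s z≤n
    ... | no d≢c = s≤s (bounded le (∈-delete⁺ d∈ d≢c))
    inj : ∀ {d e} → d ∈ cs → e ∈ cs → prepend c τ d ≡ prepend c τ e → d ≡ e
    inj {d} {e} d∈ e∈ eq with d ≟ᶜ c | e ≟ᶜ c
    ... | yes p | yes q = trans p (sym q)
    ... | yes p | no q  = contradiction (ℕ.suc-injective eq) (ℕ.<⇒≢ (positive le (∈-delete⁺ e∈ q)))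
    ... | no p  | yes q = contradiction (sym (ℕ.suc-injective eq)) (ℕ.<⇒≢ (positive le (∈-delete⁺ d∈ p)))
    ... | no p  | no q  = injective le (∈-delete⁺ d∈ p) (∈-delete⁺ e∈ q) (ℕ.suc-injective eq)
    mono : ∀ {d e} → d ∈ cs → e ∈ cs → T (adjacentᵇ d e) → prepend c τ d < prepend c τ e
    mono {d} {e} d∈ e∈ adj with d ≟ᶜ c | e ≟ᶜ c
    ... | _     | yes refl = contradiction adj (min d∈)
    ... | yes p | no q     = s≤s (positive le (∈-delete⁺ e∈ q))
    ... | no p  | no q     = s≤s (monotone le (∈-delete⁺ d∈ p) (∈-delete⁺ e∈ q) adj)

  -- Injectivity reserves the label 1 for c, so every other label is at least 2 and `pred` is a
  -- genuine decrement on it.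
  pred-isLinearExtension : ∀ {c τ} → c ∈ cs → τ c ≡ 1 → IsLinearExtension cs τ → IsLinearExtension (delete c cs) (pred ∘ τ)
  pred-isLinearExtension {c} {τ} c∈ τc≡1 le = record
    { positive  = λ d∈ → ℕ.≤-pred (big d∈)
    ; bounded   = λ d∈ → ℕ.≤-pred (subst₂ _≤_ (sym (pos d∈)) (length-delete u c∈) (bounded le (proj₁ (∈-delete⁻ d∈))))
    ; injective = λ d∈ e∈ eq → injective le (proj₁ (∈-delete⁻ d∈)) (proj₁ (∈-delete⁻ e∈))
                                 (trans (sym (pos d∈)) (trans (cong suc eq) (pos e∈)))
    ; monotone  = λ d∈ e∈ adj → ℕ.≤-pred (subst₂ _<_ (sym (pos d∈)) (sym (pos e∈))
                                 (monotone le (proj₁ (∈-delete⁻ d∈)) (proj₁ (∈-delete⁻ e∈)) adj))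
    }
    where
    pos : ∀ {d} → d ∈ delete c cs → suc (pred (τ d)) ≡ τ d
    pos {d} d∈ with τ d | positive le (proj₁ (∈-delete⁻ d∈))
    ... | suc _ | _ = refl
    big : ∀ {d} → d ∈ delete c cs → 2 ≤ suc (pred (τ d))
    big {d} d∈ = subst (2 ≤_) (sym (pos d∈)) (ℕ.≤∧≢⇒< (positive le (proj₁ (∈-delete⁻ d∈)))
      (λ 1≡τd → proj₂ (∈-delete⁻ d∈) (injective le (proj₁ (∈-delete⁻ d∈)) c∈ (trans (sym 1≡τd) (sym τc≡1)))))

  -- If 1 were missed, the distinct labels would all lie among the `length cs` - 1 numbers from 2 to
  -- `length cs`.
  smallest : ∀ {τ} → cs ≢ [] → IsLinearExtension cs τ → ∃ λ c → c ∈ cs × τ c ≡ 1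
  smallest {τ} ne le with _∈?_ ℕ._≟_ 1 (map τ cs)
  ... | yes 1∈ = let (c , c∈ , eq) = ∈-map⁻ τ 1∈ in c , c∈ , sym eq
  ... | no 1∉  = contradiction
    (subst₂ _≤_ (length-map τ cs) (length-applyUpTo (suc ∘ suc) (pred (length cs)))
      (unique-⊆-length (map-unique-local u (injective le)) ≥2))
    (ℕ.<⇒≱ (pred<length cs ne))
    where
    pred<length : ∀ (xs : List Cell) → xs ≢ [] → pred (length xs) < length xs
    pred<length []      h = contradiction refl h
    pred<length (_ ∷ _) _ = ℕ.≤-refl
    ≥2 : ∀ {x} → x ∈ map τ cs → x ∈ applyUpTo (suc ∘ suc) (pred (length cs))
    ≥2 x∈ with ∈-map⁻ τ x∈
    ... | c , c∈ , refl with τ c | positive le c∈ | bounded le c∈ | ℕ._≟_ 1 (τ c)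
    ...   | suc zero    | _ | _   | _ = contradiction x∈ 1∉
    ...   | suc (suc i) | _ | i<n | _ = ∈-applyUpTo⁺ (suc ∘ suc) (ℕ.<⇒≤pred i<n)

  insertMin : Cell → List ℕ → List ℕ
  insertMin c v = map (prepend c (valueAt (delete c cs) v)) cs

  insertMin-pred : ∀ {c τ} → (∀ {d} → d ∈ cs → 1 ≤ τ d) → τ c ≡ 1 → insertMin c (map (pred ∘ τ) (delete c cs)) ≡ map τ cs
  insertMin-pred {c} {τ} pos τc≡1 = map-cong-∈ restore
    where
    restore : ∀ {d} → d ∈ cs → prepend c (valueAt (delete c cs) (map (pred ∘ τ) (delete c cs))) d ≡ τ d
    restore {d} d∈ with d ≟ᶜ c
    ... | yes refl = sym τc≡1
    ... | no d≢c   = trans (cong suc (valueAt-map (pred ∘ τ) (∈-delete⁺ d∈ d≢c)))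
                           (ℕ.suc-pred (τ d) {{ℕ.>-nonZero (pos d∈)}})

  -- The words are sorted by the cell that carries 1; different cells give disjoint classes, since a
  -- cell other than the inserted one has a label above 1. Two duplicate-free lists with the same
  -- elements are permutations of each other. Without cells the identity fails: the empty word
  -- counts once, but no cell is minimal.
  length-linearExtensions : cs ≢ [] → ∀ M → Unique M → (∀ c → c ∈ M ⇔ Minimal cs c) →
    length (linearExtensions cs) ≡ sum (map (λ c → length (linearExtensions (delete c cs))) M)
  length-linearExtensions ne M uM M⇔ = begin
    length (linearExtensions cs)     ≡⟨ ↭-length (∼bag⇒↭ (unique∧set⇒bag (linearExtensions-unique cs) uY (mk⇔ X⊆Y Y⊆X))) ⟩
    length (concatMap f M)           ≡⟨ length-concatMap f M ⟩
    sum (map (length ∘ f) M)         ≡⟨ cong sum (map-cong-∈ {xs = M} (λ {c} _ → length-map (insertMin c) (linearExtensions (delete c cs)))) ⟩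
    sum (map (λ c → length (linearExtensions (delete c cs))) M) ∎
    where
    f : Cell → List (List ℕ)
    f c = map (insertMin c) (linearExtensions (delete c cs))
    insertMin-injective : ∀ {c v₁ v₂} → v₁ ∈ linearExtensions (delete c cs) → v₂ ∈ linearExtensions (delete c cs) →
      insertMin c v₁ ≡ insertMin c v₂ → v₁ ≡ v₂
    insertMin-injective {c} {v₁} {v₂} v₁∈ v₂∈ eq = begin
      v₁                                              ≡⟨ proj₁ (∈-linearExtensions⁻ (delete-unique c) v₁∈) ⟨
      map (valueAt (delete c cs) v₁) (delete c cs)    ≡⟨ map-cong-∈ agree ⟩
      map (valueAt (delete c cs) v₂) (delete c cs)    ≡⟨ proj₁ (∈-linearExtensions⁻ (delete-unique c) v₂∈) ⟩
      v₂ ∎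
      where
      agree : ∀ {d} → d ∈ delete c cs → valueAt (delete c cs) v₁ d ≡ valueAt (delete c cs) v₂ d
      agree {d} d∈ = ℕ.suc-injective (begin
        suc (valueAt (delete c cs) v₁ d)            ≡⟨ prepend-other (valueAt (delete c cs) v₁) (proj₂ (∈-delete⁻ d∈)) ⟨
        prepend c (valueAt (delete c cs) v₁) d      ≡⟨ map-≗-local⁻ eq (proj₁ (∈-delete⁻ d∈)) ⟩
        prepend c (valueAt (delete c cs) v₂) d      ≡⟨ prepend-other (valueAt (delete c cs) v₂) (proj₂ (∈-delete⁻ d∈)) ⟩
        suc (valueAt (delete c cs) v₂ d) ∎)
    disjoint : ∀ {c d v} → c ∈ M → d ∈ M → v ∈ f c → v ∈ f d → c ≡ d
    disjoint {c} {d} c∈M d∈M v∈c v∈d with c ≟ᶜ d | ∈-map⁻ (insertMin c) v∈c | ∈-map⁻ (insertMin d) v∈d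
    ... | yes c≡d | _ | _ = c≡d
    ... | no c≢d  | v₁ , v₁∈ , refl | v₂ , v₂∈ , eq = contradiction
      (ℕ.suc-injective (begin
        1                                       ≡⟨ prepend-self c (valueAt (delete c cs) v₁) ⟨
        prepend c (valueAt (delete c cs) v₁) c  ≡⟨ map-≗-local⁻ eq c∈ ⟩
        prepend d (valueAt (delete d cs) v₂) c  ≡⟨ prepend-other (valueAt (delete d cs) v₂) c≢d ⟩
        suc (valueAt (delete d cs) v₂ c) ∎))
      (ℕ.<⇒≢ (positive (proj₂ (∈-linearExtensions⁻ (delete-unique d) v₂∈)) (∈-delete⁺ c∈ c≢d)))
      where
      c∈ : c ∈ cs
      c∈ = proj₁ (to (M⇔ c) c∈M)
    uY : Unique (concatMap f M)
    uY = concatMap-unique f uM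
      (λ {c} _ → map-unique-local (linearExtensions-unique (delete c cs)) insertMin-injective)
      disjoint
    Y⊆X : ∀ {v} → v ∈ concatMap f M → v ∈ linearExtensions cs
    Y⊆X v∈ with find (∈-concatMap⁻ f {xs = M} v∈)
    ... | c , c∈M , v∈c with ∈-map⁻ (insertMin c) v∈c
    ...   | v′ , v′∈ , refl = ∈-linearExtensions⁺ u
              (prepend-isLinearExtension (to (M⇔ c) c∈M) (proj₂ (∈-linearExtensions⁻ (delete-unique c) v′∈)))
    X⊆Y : ∀ {v} → v ∈ linearExtensions cs → v ∈ concatMap f M
    X⊆Y {v} v∈ = ∈-concatMap⁺ f (lose (from (M⇔ c) (c∈ , minimal))
        (subst (_∈ f c) eq (∈-map⁺ (insertMin c) (∈-linearExtensions⁺ (delete-unique c) le′))))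
      where
      τ : Cell → ℕ
      τ = valueAt cs v
      le : IsLinearExtension cs τ
      le = proj₂ (∈-linearExtensions⁻ u v∈)
      c : Cell
      c = proj₁ (smallest ne le)
      c∈ : c ∈ cs
      c∈ = proj₁ (proj₂ (smallest ne le))
      τc≡1 : τ c ≡ 1
      τc≡1 = proj₂ (proj₂ (smallest ne le))
      minimal : ∀ {d} → d ∈ cs → ¬ T (adjacentᵇ d c)
      minimal {d} d∈ adj = ℕ.<⇒≱ (monotone le d∈ c∈ adj) (subst (_≤ τ d) (sym τc≡1) (positive le d∈))
      le′ : IsLinearExtension (delete c cs) (pred ∘ τ)
      le′ = pred-isLinearExtension c∈ τc≡1 le
      eq : insertMin c (map (pred ∘ τ) (delete c cs)) ≡ v
      eq = trans (insertMin-pred (positive le) τc≡1) (proj₁ (∈-linearExtensions⁻ u v∈))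

-- Skew diagrams

filter-filter : ∀ {A : Set} {P Q R : Pred A 0ℓ} (P? : Decidable P) (Q? : Decidable Q) (R? : Decidable R) →
  ∀ xs → (∀ {x} → x ∈ xs → R x ⇔ (Q x × P x)) → filter P? (filter Q? xs) ≡ filter R? xs
filter-filter P? Q? R? []       _ = refl
filter-filter P? Q? R? (x ∷ xs) h with Q? x | R? x
... | no ¬q | yes r = contradiction (proj₁ (to (h (here refl)) r)) ¬q
... | no ¬q | no ¬r = filter-filter P? Q? R? xs (h ∘ there)
... | yes q | r? with P? x | r?
...   | yes p | yes r = cong (x ∷_) (filter-filter P? Q? R? xs (h ∘ there))
...   | no ¬p | no ¬r = filter-filter P? Q? R? xs (h ∘ there)
...   | yes p | no ¬r = contradiction (from (h (here refl)) (q , p)) ¬r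
...   | no ¬p | yes r = contradiction (proj₂ (to (h (here refl)) r)) ¬p

∈-cells⁻ : ∀ μ {i j} → (i , j) ∈ cells μ → j < row μ i
∈-cells⁻ (a ∷ as) c∈ with ∈-++⁻ (map (0 ,_) (upTo a)) c∈
... | inj₁ c∈row with ∈-map⁻ (0 ,_) c∈row
...   | j , j∈ , refl = ∈-upTo⁻ j∈
∈-cells⁻ (a ∷ as) c∈ | inj₂ c∈rest with ∈-map⁻ shiftDown (subst (_ ∈_) (cellsFrom-suc 0 as) c∈rest)
...   | (i , j) , c∈′ , refl = ∈-cells⁻ as c∈′

∈-cells⁺ : ∀ μ {i j} → j < row μ i → (i , j) ∈ cells μ
∈-cells⁺ (a ∷ as) {zero}  j<a = ∈-++⁺ˡ (∈-map⁺ (0 ,_) (∈-upTo⁺ j<a))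
∈-cells⁺ (a ∷ as) {suc i} {j} j<r = ∈-++⁺ʳ (map (0 ,_) (upTo a))
  (subst ((suc i , j) ∈_) (sym (cellsFrom-suc 0 as)) (∈-map⁺ shiftDown (∈-cells⁺ as j<r)))

cells-unique : ∀ μ → Unique (cells μ)
cells-unique []       = []
cells-unique (a ∷ as) rewrite cellsFrom-suc 0 as = Unique.++⁺
  (Unique.map⁺ ,-injectiveʳ (Unique.upTo⁺ a))
  (Unique.map⁺ (λ eq → cong₂ _,_ (ℕ.suc-injective (,-injectiveˡ eq)) (,-injectiveʳ eq)) (cells-unique as))
  λ (v∈₁ , v∈₂) → let (_ , _ , p) = ∈-map⁻ (0 ,_) v∈₁ ; (_ , _ , q) = ∈-map⁻ shiftDown v∈₂ in
    ℕ.0≢1+n (,-injectiveˡ (trans (sym p) q))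

-- Definitionally the test inside `skewCells`, in the form that the lemmas on `filter` accept.
skew? : ∀ μ → Decidable (λ (c : Cell) → T (row μ (proj₁ c) <ᵇ suc (proj₂ c)))
skew? μ c = T? (row μ (proj₁ c) <ᵇ suc (proj₂ c))

∈-skewCells⁻ : ∀ {la mu i j} → (i , j) ∈ skewCells la mu → row mu i ≤ j × j < row la i
∈-skewCells⁻ {la} {mu} {i} {j} c∈ with ∈-filter⁻ (skew? mu) {xs = cells la} c∈
... | c∈cells , t = ℕ.≤-pred (ℕ.<ᵇ⇒< (row mu i) (suc j) t) , ∈-cells⁻ la c∈cells

∈-skewCells⁺ : ∀ {la mu i j} → row mu i ≤ j → j < row la i → (i , j) ∈ skewCells la mu
∈-skewCells⁺ {la} {mu} r≤j j<r = ∈-filter⁺ (skew? mu) (∈-cells⁺ la j<r) (ℕ.<⇒<ᵇ (s≤s r≤j))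

skewCells-unique : ∀ la mu → Unique (skewCells la mu)
skewCells-unique la mu = Unique.filter⁺ (skew? mu) (cells-unique la)

-- Boxes added to μ inside a larger diagram

row-inc-same : ∀ μ i → i ≤ length μ → row (inc μ i) i ≡ suc (row μ i)
row-inc-same []       zero    _         = refl
row-inc-same (a ∷ as) zero    _         = refl
row-inc-same (a ∷ as) (suc i) (s≤s i≤n) = row-inc-same as i i≤n

row-inc-other : ∀ μ i {j} → i ≤ length μ → j ≢ i → row (inc μ i) j ≡ row μ j
row-inc-other []       zero    {zero}  _ j≢i = contradiction refl j≢i
row-inc-other []       zero    {suc j} _ _   = refl
row-inc-other (a ∷ as) zero    {zero}  _ j≢i = contradiction refl j≢i
row-inc-other (a ∷ as) zero    {suc j} _ _   = refl
row-inc-other (a ∷ as) (suc i) {zero}  _ _   = refl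
row-inc-other (a ∷ as) (suc i) {suc j} (s≤s i≤n) j≢i = row-inc-other as i i≤n (j≢i ∘ cong suc)

inc-⊆⇔ : ∀ {la} μ i → i ≤ length μ → inc μ i ⊆ la ⇔ (μ ⊆ la × row μ i < row la i)
inc-⊆⇔ {la} μ i i≤n = mk⇔
  (λ sub → (λ j → below j sub) , subst (_≤ row la i) (row-inc-same μ i i≤n) (sub i))
  (λ (sub , lt) j → above j sub lt)
  where
  below : ∀ j → inc μ i ⊆ la → row μ j ≤ row la j
  below j sub with j ℕ.≟ i
  ... | yes refl = ℕ.<⇒≤ (subst (_≤ row la i) (row-inc-same μ i i≤n) (sub i))
  ... | no j≢i   = subst (_≤ row la j) (row-inc-other μ i i≤n j≢i) (sub j)
  above : ∀ j → μ ⊆ la → row μ i < row la i → row (inc μ i) j ≤ row la j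
  above j sub lt with j ℕ.≟ i
  ... | yes refl = subst (_≤ row la i) (sym (row-inc-same μ i i≤n)) lt
  ... | no j≢i   = subst (_≤ row la j) (sym (row-inc-other μ i i≤n j≢i)) (sub j)

-- Both sides filter `cells la`: in row i, being at or beyond `row μ i` but not equal to it is the
-- test for the longer row. The lists agree even in order, so the counts transfer without a
-- permutation.
delete-skewCells : ∀ la μ i → i ≤ length μ → delete (i , row μ i) (skewCells la μ) ≡ skewCells la (inc μ i)
delete-skewCells la μ i i≤n = filter-filter (λ d → ¬? (d ≟ᶜ (i , row μ i))) (skew? μ) (skew? (inc μ i)) (cells la)
  (λ {c} _ → mk⇔ (⇒ c) (⇐ c))
  where
  ⇒ : ∀ c → T (row (inc μ i) (proj₁ c) <ᵇ suc (proj₂ c)) → T (row μ (proj₁ c) <ᵇ suc (proj₂ c)) × c ≢ (i , row μ i)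
  ⇒ (k , j) t with k ℕ.≟ i
  ... | yes refl rewrite row-inc-same μ k i≤n =
    ℕ.<⇒<ᵇ (ℕ.<⇒≤ (ℕ.<ᵇ⇒< (suc (row μ k)) (suc j) t)) ,
    (λ eq → ℕ.<⇒≢ (ℕ.≤-pred (ℕ.<ᵇ⇒< (suc (row μ k)) (suc j) t)) (sym (,-injectiveʳ eq)))
  ... | no k≢i rewrite row-inc-other μ i i≤n k≢i = t , (λ eq → k≢i (,-injectiveˡ eq))
  ⇐ : ∀ c → T (row μ (proj₁ c) <ᵇ suc (proj₂ c)) × c ≢ (i , row μ i) → T (row (inc μ i) (proj₁ c) <ᵇ suc (proj₂ c))
  ⇐ (k , j) (t , c≢) with k ℕ.≟ i
  ... | yes refl rewrite row-inc-same μ k i≤n =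
    ℕ.<⇒<ᵇ (s≤s (ℕ.≤∧≢⇒< (ℕ.≤-pred (ℕ.<ᵇ⇒< (row μ k) (suc j) t)) (λ eq → c≢ (cong (k ,_) (sym eq)))))
  ... | no k≢i rewrite row-inc-other μ i i≤n k≢i = t

adjacentᵇ⁻ : ∀ {i j i′ j′} → T (adjacentᵇ (i , j) (i′ , j′)) → (i ≡ i′ × suc j ≡ j′) ⊎ (suc i ≡ i′ × j ≡ j′)
adjacentᵇ⁻ {i} {j} {i′} {j′} t with to (T-∨ {(i ≡ᵇ i′) ∧ (suc j ≡ᵇ j′)}) t
... | inj₁ s = let (p , q) = to (T-∧ {i ≡ᵇ i′}) s in inj₁ (ℕ.≡ᵇ⇒≡ i i′ p , ℕ.≡ᵇ⇒≡ (suc j) j′ q)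
... | inj₂ s = let (p , q) = to (T-∧ {suc i ≡ᵇ i′}) s in inj₂ (ℕ.≡ᵇ⇒≡ (suc i) i′ p , ℕ.≡ᵇ⇒≡ j j′ q)

adjacentᵇ-right : ∀ i j → T (adjacentᵇ (i , j) (i , suc j))
adjacentᵇ-right i j = from (T-∨ {(i ≡ᵇ i) ∧ (suc j ≡ᵇ suc j)}) (inj₁ (from (T-∧ {i ≡ᵇ i}) (ℕ.≡⇒≡ᵇ i i refl , ℕ.≡⇒≡ᵇ j j refl)))

adjacentᵇ-below : ∀ i j → T (adjacentᵇ (i , j) (suc i , j))
adjacentᵇ-below i j = from (T-∨ {(i ≡ᵇ suc i) ∧ (suc j ≡ᵇ j)}) (inj₂ (from (T-∧ {i ≡ᵇ i}) (ℕ.≡⇒≡ᵇ i i refl , ℕ.≡⇒≡ᵇ j j refl)))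

row-suc-≤ : ∀ {as} → Decreasing as → ∀ i → row as (suc i) ≤ row as i
row-suc-≤ {[]}     _ _       = z≤n
row-suc-≤ {a ∷ as} d zero    = decreasing-head d
row-suc-≤ {a ∷ as} d (suc i) = row-suc-≤ (Linked.tail d) i

inc-decreasing : ∀ {μ} → Decreasing μ → ∀ i → (∀ k → i ≡ suc k → row μ i < row μ k) → Decreasing (inc μ i)
inc-decreasing {[]}     _ _       _ = [-]
inc-decreasing {a ∷ as} d zero    _ = decreasing-cons (ℕ.m≤n⇒m≤1+n (decreasing-head d)) (Linked.tail d)
inc-decreasing {a ∷ as} d (suc i) h = decreasing-cons (head as i (decreasing-head d) (h 0) (h i refl))
  (inc-decreasing (Linked.tail d) i (λ { k refl → h (suc k) refl }))
  where
  head : ∀ as i → row as 0 ≤ a → (suc i ≡ 1 → row as i < a) → row as i < row (a ∷ as) i → row (inc as i) 0 ≤ a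
  head []       zero    _   h₀ _ = h₀ refl
  head (b ∷ bs) zero    _   h₀ _ = h₀ refl
  head (b ∷ bs) (suc i) b≤a _  _ = b≤a

row-pos⇒< : ∀ μ {i} → 0 < row μ i → i < length μ
row-pos⇒< (a ∷ as) {zero}  _ = s≤s z≤n
row-pos⇒< (a ∷ as) {suc i} p = s≤s (row-pos⇒< as p)

growable? : ∀ la μ → Decidable (λ i → Decreasing (inc μ i) × row μ i < row la i)
growable? la μ i = decreasing? (inc μ i) ×-dec (row μ i ℕ.<? row la i)

growableRows : List ℕ → List ℕ → List ℕ
growableRows la μ = filter (growable? la μ) (upTo (suc (length μ)))

rowEnd : List ℕ → ℕ → Cell
rowEnd μ i = i , row μ i

-- Without a left neighbour the cell sits at the end of its row in μ. The cell above it, if any,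
-- lies in `la` but not in the skew shape, hence in μ, so the row above is strictly longer and the
-- box fits. Conversely, a skew cell above the row end would contradict that `inc μ i` is
-- decreasing.
minimal⇔growable : ∀ {la μ} → Decreasing la → Decreasing μ → ∀ c →
  c ∈ map (rowEnd μ) (growableRows la μ) ⇔ Minimal (skewCells la μ) c
minimal⇔growable {la} {μ} dla dμ c = mk⇔ ⇒ ⇐
  where
  ⇒ : ∀ {c} → c ∈ map (rowEnd μ) (growableRows la μ) → Minimal (skewCells la μ) c
  ⇒ c∈ with ∈-map⁻ (rowEnd μ) c∈
  ... | i , i∈ , refl with ∈-filter⁻ (growable? la μ) {xs = upTo (suc (length μ))} i∈
  ...   | i∈upTo , dinc , r<r = ∈-skewCells⁺ {la} {μ} ℕ.≤-refl r<r , λ {d} → min {d}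
    where
    i≤n : i ≤ length μ
    i≤n = ℕ.≤-pred (∈-upTo⁻ i∈upTo)
    min : ∀ {d} → d ∈ skewCells la μ → ¬ T (adjacentᵇ d (i , row μ i))
    min {k , j} d∈ adj with adjacentᵇ⁻ {k} {j} {i} adj | ∈-skewCells⁻ {la} {μ} d∈
    ... | inj₁ (refl , 1+j≡r) | r≤j , _ = ℕ.<⇒≱ (ℕ.≤-reflexive 1+j≡r) r≤j
    ... | inj₂ (refl , refl)  | r≤j , _ = ℕ.<⇒≱
      (subst₂ _≤_ (row-inc-same μ (suc k) i≤n) (row-inc-other μ (suc k) i≤n (ℕ.<⇒≢ ℕ.≤-refl)) (row-suc-≤ dinc k)) r≤j
  ⇐ : ∀ {c} → Minimal (skewCells la μ) c → c ∈ map (rowEnd μ) (growableRows la μ)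
  ⇐ {i , j} (c∈ , min) = subst (λ z → (i , z) ∈ map (rowEnd μ) (growableRows la μ)) r≡j
    (∈-map⁺ (rowEnd μ) (∈-filter⁺ (growable? la μ) (∈-upTo⁺ (s≤s i≤n)) (inc-decreasing dμ i above , r<r)))
    where
    r≤j : row μ i ≤ j
    r≤j = proj₁ (∈-skewCells⁻ {la} {μ} c∈)
    j<r : j < row la i
    j<r = proj₂ (∈-skewCells⁻ {la} {μ} c∈)
    r<r : row μ i < row la i
    r<r = ℕ.≤-<-trans r≤j j<r
    leftmost : ∀ j → row μ i ≤ j → j < row la i → (∀ {d} → d ∈ skewCells la μ → ¬ T (adjacentᵇ d (i , j))) → row μ i ≡ j
    leftmost j r≤j j<r min with ℕ.m≤n⇒m<n∨m≡n r≤j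
    ... | inj₂ eq = eq
    leftmost (suc j) _ j<r min | inj₁ r<1+j =
      contradiction (adjacentᵇ-right i j) (min (∈-skewCells⁺ {la} {μ} (ℕ.≤-pred r<1+j) (ℕ.<⇒≤ j<r)))
    r≡j : row μ i ≡ j
    r≡j = leftmost j r≤j j<r min
    above : ∀ k → i ≡ suc k → row μ i < row μ k
    above k refl = ℕ.≰⇒> λ rk≤ri → min
      (∈-skewCells⁺ {la} {μ} (ℕ.≤-trans rk≤ri r≤j) (ℕ.<-≤-trans j<r (row-suc-≤ dla k))) (adjacentᵇ-below k j)
    -- A box that fits in row k + 1 needs a non-empty row k in μ, so the range of rows in
    -- `growableRows` misses no cell.
    bound : ∀ i → (∀ k → i ≡ suc k → row μ i < row μ k) → i ≤ length μ
    bound zero    _ = z≤n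
    bound (suc k) h = row-pos⇒< μ (ℕ.≤-<-trans z≤n (h k refl))
    i≤n : i ≤ length μ
    i≤n = bound i above

⊆⇒size-≤ : ∀ mu la → mu ⊆ la → size mu ≤ size la
⊆⇒size-≤ []       la       _   = z≤n
⊆⇒size-≤ (m ∷ ms) []       sub = ℕ.+-mono-≤ (sub 0) (⊆⇒size-≤ ms [] (sub ∘ suc))
⊆⇒size-≤ (m ∷ ms) (l ∷ ls) sub = ℕ.+-mono-≤ (sub 0) (⊆⇒size-≤ ms ls (sub ∘ suc))

skewCells-nonempty : ∀ {la mu} → size mu < size la → skewCells la mu ≢ []
skewCells-nonempty {la} {mu} lt eq = ℕ.<⇒≱ lt (⊆⇒size-≤ la mu λ i → ℕ.≮⇒≥ λ r<r →
  ∉[] (subst ((i , row mu i) ∈_) eq (∈-skewCells⁺ {la} {mu} ℕ.≤-refl r<r)))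

numSYT-step : ∀ {la μ} → Decreasing la → Decreasing μ → size μ < size la →
  numSYT la μ ≡ sum (map (λ i → numSYT la (inc μ i)) (growableRows la μ))
numSYT-step {la} {μ} dla dμ lt = begin
  numSYT la μ
    ≡⟨ length-linearExtensions (skewCells-unique la μ) (skewCells-nonempty {la} {μ} lt) (map (rowEnd μ) (growableRows la μ))
         (Unique.map⁺ ,-injectiveˡ (Unique.filter⁺ (growable? la μ) (Unique.upTo⁺ (suc (length μ)))))
         (minimal⇔growable dla dμ) ⟩
  sum (map (λ c → length (linearExtensions (delete c (skewCells la μ)))) (map (rowEnd μ) (growableRows la μ)))
    ≡⟨ cong sum (map-∘ (growableRows la μ)) ⟨
  sum (map (λ i → length (linearExtensions (delete (i , row μ i) (skewCells la μ)))) (growableRows la μ))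
    ≡⟨ cong sum (map-cong-∈ (λ {i} i∈ → cong (length ∘ linearExtensions)
         (delete-skewCells la μ i (ℕ.≤-pred (∈-upTo⁻ (proj₁ (∈-filter⁻ (growable? la μ) {xs = upTo (suc (length μ))} i∈))))))) ⟩
  sum (map (λ i → numSYT la (inc μ i)) (growableRows la μ)) ∎

numSYT-self : ∀ μ → numSYT μ μ ≡ 1
numSYT-self μ = cong (length ∘ linearExtensions) (filter-none (skew? μ) {cells μ}
  (All.tabulate λ {(i , j)} c∈ t → ℕ.<⇒≱ (∈-cells⁻ μ c∈) (ℕ.≤-pred (ℕ.<ᵇ⇒< (row μ i) (suc j) t))))

-- Positivity excludes trailing zeros, by which lists with the same diagram could still differ.
⊆∧size-≡ : ∀ {mu la} → All (0 <_) mu → All (0 <_) la → mu ⊆ la → size mu ≡ size la → mu ≡ la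
⊆∧size-≡ {[]}     {[]}     _       _       _   _  = refl
⊆∧size-≡ {[]}     {l ∷ ls} _       (p ∷ _) _   eq = contradiction eq (ℕ.<⇒≢ (ℕ.m≤n⇒m≤n+o (size ls) p))
⊆∧size-≡ {m ∷ ms} {[]}     (p ∷ _) _       sub _  = contradiction (sub 0) (ℕ.<⇒≱ p)
⊆∧size-≡ {m ∷ ms} {l ∷ ls} (_ ∷ ps) (_ ∷ qs) sub eq with ℕ.m≤n⇒m<n∨m≡n (sub 0)
... | inj₁ m<l  = contradiction eq (ℕ.<⇒≢ (ℕ.+-mono-<-≤ m<l (⊆⇒size-≤ ms ls (sub ∘ suc))))
... | inj₂ refl = cong (m ∷_) (⊆∧size-≡ ps qs (sub ∘ suc) (ℕ.+-cancelˡ-≡ m _ _ eq))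

-- Harmonic functions of the growth process

module _ {A : Set} where

  Σℚ : (A → ℚ) → List A → ℚ
  Σℚ f xs = sumℚ (map f xs)

  Σℚ-cong : ∀ {f g : A → ℚ} xs → (∀ {x} → x ∈ xs → f x ≡ g x) → Σℚ f xs ≡ Σℚ g xs
  Σℚ-cong xs eq = cong sumℚ (map-cong-∈ {xs = xs} eq)

  Σℚ-*ˡ : ∀ c (f : A → ℚ) xs → Σℚ (λ x → c * f x) xs ≡ c * Σℚ f xs
  Σℚ-*ˡ c f []       = sym (ℚ.*-zeroʳ c)
  Σℚ-*ˡ c f (x ∷ xs) = trans (cong (c * f x +_) (Σℚ-*ˡ c f xs)) (sym (ℚ.*-distribˡ-+ c (f x) (Σℚ f xs)))

  Σℚ-Σrows-swap : ∀ μ (f : A → ℕ → ℚ) xs → Σℚ (λ x → Σrows μ (f x)) xs ≡ Σrows μ (λ i → Σℚ (λ x → f x i) xs)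
  Σℚ-Σrows-swap μ f []       = sym (zero-sum μ)
    where
    zero-sum : ∀ μ → Σrows μ (λ _ → 0ℚ) ≡ 0ℚ
    zero-sum []       = refl
    zero-sum (_ ∷ as) = cong (0ℚ +_) (zero-sum as)
  Σℚ-Σrows-swap μ f (x ∷ xs) = trans (cong (Σrows μ (f x) +_) (Σℚ-Σrows-swap μ f xs))
    (sym (Σrows-+ μ (f x) (λ i → Σℚ (λ x → f x i) xs)))

  Σℚ-filter : ∀ {P : Pred A 0ℓ} (P? : Decidable P) (f : A → ℚ) xs →
    Σℚ (λ x → if does (P? x) then f x else 0ℚ) xs ≡ Σℚ f (filter P? xs)
  Σℚ-filter P? f []       = refl
  Σℚ-filter P? f (x ∷ xs) with does (P? x)
  ... | true  = cong (f x +_) (Σℚ-filter P? f xs)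
  ... | false = trans (ℚ.+-identityˡ _) (Σℚ-filter P? f xs)

  ℕ→ℚ-sum : ∀ (f : A → ℕ) xs → ℕ→ℚ (sum (map f xs)) ≡ Σℚ (ℕ→ℚ ∘ f) xs
  ℕ→ℚ-sum f []       = refl
  ℕ→ℚ-sum f (x ∷ xs) = trans (ℕ→ℚ-+ (f x) (sum (map f xs))) (cong (ℕ→ℚ (f x) +_) (ℕ→ℚ-sum f xs))

Σℚ-upTo : ∀ μ (f : ℕ → ℚ) → Σℚ f (upTo (suc (length μ))) ≡ Σrows μ f
Σℚ-upTo μ f = go μ (λ i → i)
  where
  go : ∀ μ (φ : ℕ → ℕ) → Σℚ f (applyUpTo φ (suc (length μ))) ≡ Σrows μ (f ∘ φ)
  go []       φ = ℚ.+-identityʳ (f (φ 0))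
  go (_ ∷ as) φ = cong (f (φ 0) +_) (go as (φ ∘ suc))

inc-positive : ∀ {μ} i → All (0 <_) μ → All (0 <_) (inc μ i)
inc-positive i       []       = s≤s z≤n ∷ []
inc-positive zero    (_ ∷ ps) = s≤s z≤n ∷ ps
inc-positive (suc i) (p ∷ ps) = p ∷ inc-positive i ps

size-inc : ∀ μ i → i ≤ length μ → size (inc μ i) ≡ suc (size μ)
size-inc []       zero    _         = refl
size-inc (a ∷ as) zero    _         = refl
size-inc (a ∷ as) (suc i) (s≤s i≤n) = trans (cong (a ℕ.+_) (size-inc as i i≤n)) (ℕ.+-suc a (size as))

recipHook : List ℕ → ℚ
recipHook la = recip (hookProduct la) {{hookProduct-nonZero la}}

IsPartitionsAbove : List ℕ → ℕ → List (List ℕ) → Set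
IsPartitionsAbove mu n L = ∀ la → (la ∈ L) ⇔ (IsPartition la × size la ≡ n × mu ⊆ la)

-- H_μ stays outside as a factor: in the induction it becomes the weight times H of the enlarged
-- partition, while inside the sum only the number of tableaux depends on μ.
expectation : List ℕ → List (List ℕ) → (List ℕ → ℚ) → ℚ
expectation mu L h = Σℚ (λ la → ℕ→ℚ (numSYT la mu) * (recipHook la * h la)) L

-- A row without room for a box enters with weight 0, whatever value `h` takes at the non-partition
-- `inc μ i`.
Harmonic : (List ℕ → ℚ) → Set
Harmonic h = ∀ μ → Decreasing μ → Σrows μ (λ i → addWeight μ i * h (inc μ i)) ≡ h μ

partitionsAbove-self : ∀ {mu} → IsPartition mu → ∀ {L} → Unique L → IsPartitionsAbove mu (size mu) L → L ≡ mu ∷ []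
partitionsAbove-self {mu} pmu {L} u above = go L u (λ la∈ → sym (eq la∈)) (from (above mu) (pmu , refl , (λ _ → ℕ.≤-refl)))
  where
  eq : ∀ {la} → la ∈ L → mu ≡ la
  eq {la} la∈ = let (pla , size≡ , sub) = to (above la) la∈ in ⊆∧size-≡ (proj₂ pmu) (proj₂ pla) sub (sym size≡)
  go : ∀ L → Unique L → (∀ {la} → la ∈ L → la ≡ mu) → mu ∈ L → L ≡ mu ∷ []
  go (x ∷ [])    _               h _ = cong (_∷ []) (h (here refl))
  go (x ∷ y ∷ L) ((x≢y ∷ _) ∷ _) h _ = contradiction (trans (h (here refl)) (sym (h (there (here refl))))) x≢y

recipHook-inverse : ∀ la → hookProductℚ la * recipHook la ≡ 1ℚ
recipHook-inverse la = *-recip (hookProduct la) {{hookProduct-nonZero la}}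

-- Provides the list for the induction hypothesis by filtering `L`, so that no enumeration of
-- partitions has to be constructed.
partitionsAbove-inc : ∀ {mu n L} i → i ≤ length mu → IsPartitionsAbove mu n L →
  IsPartitionsAbove (inc mu i) n (filter (λ la → row mu i ℕ.<? row la i) L)
partitionsAbove-inc {mu} {n} {L} i i≤n above la = mk⇔
  (λ la∈ → let (la∈L , r<r) = ∈-filter⁻ (λ la → row mu i ℕ.<? row la i) {xs = L} la∈
               (pla , size≡ , sub) = to (above la) la∈L
           in pla , size≡ , from (inc-⊆⇔ {la} mu i i≤n) (sub , r<r))
  (λ (pla , size≡ , sub) → let (sub′ , r<r) = to (inc-⊆⇔ {la} mu i i≤n) sub in
    ∈-filter⁺ (λ la → row mu i ℕ.<? row la i) (from (above la) (pla , size≡ , sub′)) r<r)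

-- The growable rows depend on `la`. Indicators over all rows make the index set independent of it,
-- which permits exchanging this sum with the one over `la`.
numSYTℚ-step : ∀ {la μ} → Decreasing la → Decreasing μ → size μ < size la →
  ℕ→ℚ (numSYT la μ) ≡ Σrows μ (λ i → if does (growable? la μ i) then ℕ→ℚ (numSYT la (inc μ i)) else 0ℚ)
numSYTℚ-step {la} {μ} dla dμ lt = begin
  ℕ→ℚ (numSYT la μ)                                               ≡⟨ cong ℕ→ℚ (numSYT-step {la} {μ} dla dμ lt) ⟩
  ℕ→ℚ (sum (map (λ i → numSYT la (inc μ i)) (growableRows la μ))) ≡⟨ ℕ→ℚ-sum (λ i → numSYT la (inc μ i)) (growableRows la μ) ⟩
  Σℚ (λ i → ℕ→ℚ (numSYT la (inc μ i))) (growableRows la μ)        ≡⟨ Σℚ-filter (growable? la μ) _ (upTo (suc (length μ))) ⟨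
  Σℚ (λ i → if does (growable? la μ i) then ℕ→ℚ (numSYT la (inc μ i)) else 0ℚ) (upTo (suc (length μ)))
    ≡⟨ Σℚ-upTo μ _ ⟩
  Σrows μ (λ i → if does (growable? la μ i) then ℕ→ℚ (numSYT la (inc μ i)) else 0ℚ) ∎

expectation-harmonic : ∀ {h} → Harmonic h → ∀ d mu → IsPartition mu → ∀ {L} → Unique L →
  IsPartitionsAbove mu (d ℕ.+ size mu) L → hookProductℚ mu * expectation mu L h ≡ h mu
expectation-harmonic {h} harm zero mu pmu {L} u above = begin
  H * expectation mu L h     ≡⟨ cong (λ L → H * expectation mu L h) (partitionsAbove-self pmu u above) ⟩
  H * (ℕ→ℚ (numSYT mu mu) * (R * h mu) + 0ℚ) ≡⟨ cong (λ k → H * (ℕ→ℚ k * (R * h mu) + 0ℚ)) (numSYT-self mu) ⟩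
  H * (1ℚ * (R * h mu) + 0ℚ) ≡⟨ lem H R (h mu) ⟩
  H * R * h mu               ≡⟨ cong (_* h mu) (recipHook-inverse mu) ⟩
  1ℚ * h mu                  ≡⟨ ℚ.*-identityˡ (h mu) ⟩
  h mu ∎
  where
  H R : ℚ
  H = hookProductℚ mu
  R = recipHook mu
  lem : ∀ a b c → a * (1ℚ * (b * c) + 0ℚ) ≡ a * b * c
  lem = solve-∀ ring
expectation-harmonic {h} harm (suc d) mu pmu {L} u above = begin
  H * expectation mu L h                             ≡⟨ cong (H *_) (Σℚ-cong L expand) ⟩
  H * Σℚ (λ la → Σrows mu (λ i → g la * f la i)) L   ≡⟨ cong (H *_) (Σℚ-Σrows-swap mu (λ la i → g la * f la i) L) ⟩
  H * Σrows mu (λ i → Σℚ (λ la → g la * f la i) L)   ≡⟨ Σrows-*ˡ mu H (λ i → Σℚ (λ la → g la * f la i) L) ⟨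
  Σrows mu (λ i → H * Σℚ (λ la → g la * f la i) L)   ≡⟨ Σrows-cong mu eachRow ⟩
  Σrows mu (λ i → addWeight mu i * h (inc mu i))             ≡⟨ harm mu (proj₁ pmu) ⟩
  h mu ∎
  where
  H : ℚ
  H = hookProductℚ mu
  g : List ℕ → ℚ
  g la = recipHook la * h la
  f : List ℕ → ℕ → ℚ
  f la i = if does (growable? la mu i) then ℕ→ℚ (numSYT la (inc mu i)) else 0ℚ
  expand : ∀ {la} → la ∈ L → ℕ→ℚ (numSYT la mu) * g la ≡ Σrows mu (λ i → g la * f la i)
  expand {la} la∈ = let (pla , size≡ , _) = to (above la) la∈ in begin
    ℕ→ℚ (numSYT la mu) * g la
      ≡⟨ cong (_* g la) (numSYTℚ-step {la} {mu} (proj₁ pla) (proj₁ pmu) (subst (size mu <_) (sym size≡) (s≤s (ℕ.m≤n+m (size mu) d)))) ⟩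
    Σrows mu (f la) * g la              ≡⟨ ℚ.*-comm (Σrows mu (f la)) (g la) ⟩
    g la * Σrows mu (f la)              ≡⟨ Σrows-*ˡ mu (g la) (f la) ⟨
    Σrows mu (λ i → g la * f la i) ∎
  eachRow : ∀ i → i ≤ length mu → H * Σℚ (λ la → g la * f la i) L ≡ addWeight mu i * h (inc mu i)
  eachRow i i≤n = byCases (decreasing? (inc mu i))
    where
    row<? : Decidable (λ la → row mu i < row la i)
    row<? la = row mu i ℕ.<? row la i
    e : List ℕ → ℚ
    e la = ℕ→ℚ (numSYT la (inc mu i))
    L′ : List (List ℕ)
    L′ = filter row<? L
    zeros : ∀ a b c → a * (0ℚ * b) ≡ 0ℚ * c
    zeros = solve-∀ ring
    if-*ˡ : ∀ b x y → x * (if b then y else 0ℚ) ≡ (if b then y * x else 0ℚ)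
    if-*ˡ true  x y = ℚ.*-comm x y
    if-*ˡ false x y = ℚ.*-zeroʳ x
    -- Whether `inc mu i` is decreasing does not depend on `la`, so it is decided once outside the
    -- sum; the indicator then reduces to 0 or to the containment test for row i.
    byCases : (dec? : Dec (Decreasing (inc mu i))) →
      H * Σℚ (λ la → g la * (if does (dec? ×-dec row<? la) then e la else 0ℚ)) L ≡ addWeight mu i * h (inc mu i)
    byCases (no ¬dec) = begin
      H * Σℚ (λ la → g la * 0ℚ) L       ≡⟨ cong (H *_) (Σℚ-cong L (λ {la} _ → ℚ.*-comm (g la) 0ℚ)) ⟩
      H * Σℚ (λ la → 0ℚ * g la) L       ≡⟨ cong (H *_) (Σℚ-*ˡ 0ℚ g L) ⟩
      H * (0ℚ * Σℚ g L)                 ≡⟨ zeros H (Σℚ g L) (h (inc mu i)) ⟩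
      0ℚ * h (inc mu i)                 ≡⟨ cong (_* h (inc mu i)) (addWeight-nonaddable mu i i≤n (proj₁ pmu) ¬dec) ⟨
      addWeight mu i * h (inc mu i) ∎
    byCases (yes dec) = begin
      H * Σℚ (λ la → g la * (if does (row<? la) then e la else 0ℚ)) L
        ≡⟨ cong (H *_) (Σℚ-cong L (λ {la} _ → if-*ˡ (does (row<? la)) (g la) (e la))) ⟩
      H * Σℚ (λ la → if does (row<? la) then e la * g la else 0ℚ) L
        ≡⟨ cong₂ _*_ (hookProduct-inc mu i i≤n (proj₁ pmu) dec) (Σℚ-filter row<? (λ la → e la * g la) L) ⟩
      addWeight mu i * hookProductℚ (inc mu i) * expectation (inc mu i) L′ h   ≡⟨ ℚ.*-assoc (addWeight mu i) _ _ ⟩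
      addWeight mu i * (hookProductℚ (inc mu i) * expectation (inc mu i) L′ h)
        ≡⟨ cong (addWeight mu i *_) (expectation-harmonic harm d (inc mu i) (dec , inc-positive i (proj₂ pmu)) (Unique.filter⁺ row<? u)
             (subst (λ n → IsPartitionsAbove (inc mu i) n L′)
                (trans (sym (ℕ.+-suc d (size mu))) (cong (d ℕ.+_) (sym (size-inc mu i i≤n))))
                (partitionsAbove-inc {mu} i i≤n above))) ⟩
      addWeight mu i * h (inc mu i) ∎

-- The content statistic and its compensator

contentSq-rowEnd : ∀ μ i → ℕ→ℚ (contentSq (rowEnd μ i)) ≡ content μ i * content μ i
contentSq-rowEnd μ i = trans (ℕ→ℚ-* x (x ℕ.* 1)) (trans (cong (λ z → ℕ→ℚ x * ℕ→ℚ z) (ℕ.*-identityʳ x)) square)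
  where
  r x : ℕ
  r = row μ i
  -- One of the two truncated differences is 0, so x is the absolute value of the content; the sign
  -- disappears in the square.
  x = (r ∸ i) ℕ.+ (i ∸ r)
  neg : ∀ a b → (a - b) * (a - b) ≡ (b - a) * (b - a)
  neg = solve-∀ ring
  square : ℕ→ℚ x * ℕ→ℚ x ≡ content μ i * content μ i
  square = byCases (ℕ.≤-total i r)
    where
    byCases : i ≤ r ⊎ r ≤ i → ℕ→ℚ x * ℕ→ℚ x ≡ content μ i * content μ i
    byCases (inj₁ i≤r) = cong (λ z → z * z) (trans (cong ℕ→ℚ (trans (cong (r ∸ i ℕ.+_) (ℕ.m≤n⇒m∸n≡0 i≤r)) (ℕ.+-identityʳ _))) (ℕ→ℚ-∸ i≤r))
    byCases (inj₂ r≤i) = trans (cong (λ z → z * z) (trans (cong ℕ→ℚ (cong (ℕ._+ (i ∸ r)) (ℕ.m≤n⇒m∸n≡0 r≤i))) (ℕ→ℚ-∸ r≤i)))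
                         (neg (ℕ→ℚ i) (ℕ→ℚ r))

C1-inc : ∀ μ i → i ≤ length μ → ℕ→ℚ (C1 (inc μ i)) ≡ ℕ→ℚ (C1 μ) + content μ i * content μ i
C1-inc μ i i≤n = begin
  ℕ→ℚ (C1 (inc μ i))                              ≡⟨ cong ℕ→ℚ (sum-cellsFrom-inc contentSq 0 μ i i≤n) ⟩
  ℕ→ℚ (C1 μ ℕ.+ contentSq (rowEnd μ i))           ≡⟨ ℕ→ℚ-+ (C1 μ) _ ⟩
  ℕ→ℚ (C1 μ) + ℕ→ℚ (contentSq (rowEnd μ i))       ≡⟨ cong (ℕ→ℚ (C1 μ) +_) (contentSq-rowEnd μ i) ⟩
  ℕ→ℚ (C1 μ) + content μ i * content μ i ∎

-- The expected gain of `C1` on adding a box to a partition of size m is the second moment m, so the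
-- total drift up to size n is 0 + 1 + ... + (n - 1).
triangular : ℕ → ℚ
triangular n = ½ * (ℕ→ℚ n * (ℕ→ℚ n - 1ℚ))

triangular-suc : ∀ n → triangular (suc n) ≡ triangular n + ℕ→ℚ n
triangular-suc n = trans (cong (λ z → ½ * (z * (z - 1ℚ))) (ℕ→ℚ-suc n)) (lem (ℕ→ℚ n))
  where
  lem : ∀ a → ½ * ((1ℚ + a) * (1ℚ + a - 1ℚ)) ≡ ½ * (a * (a - 1ℚ)) + a
  lem = solve-∀ ring

compensated : ℚ → List ℕ → ℚ
compensated k la = ℕ→ℚ (C1 la) - triangular (size la) + k

compensated-harmonic : ∀ k → Harmonic (compensated k)
compensated-harmonic k μ dμ = begin
  Σrows μ (λ i → addWeight μ i * compensated k (inc μ i))       ≡⟨ Σrows-cong μ term ⟩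
  Σrows μ (λ i → addWeight μ i * (content μ i * content μ i) + x * addWeight μ i)
    ≡⟨ trans (Σrows-+ μ (λ i → addWeight μ i * (content μ i * content μ i)) (λ i → x * addWeight μ i))
         (cong₂ _+_ (moment₂ μ dμ) (trans (Σrows-*ˡ μ x (addWeight μ)) (cong (x *_) (moment₀ μ dμ)))) ⟩
  m + x * 1ℚ                                            ≡⟨ l2 c t m k ⟩
  compensated k μ ∎
  where
  c t m x : ℚ
  c = ℕ→ℚ (C1 μ)
  t = triangular (size μ)
  m = ℕ→ℚ (size μ)
  -- The part of `compensated k (inc μ i)` common to all rows, `triangular` at the enlarged size
  -- being t + m. The second moment pays back this m.
  x = c - (t + m) + k
  l1 : ∀ w s c t k → w * (c + s - t + k) ≡ w * s + (c - t + k) * w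
  l1 = solve-∀ ring
  l2 : ∀ c t m k → m + (c - (t + m) + k) * 1ℚ ≡ c - t + k
  l2 = solve-∀ ring
  term : ∀ i → i ≤ length μ → addWeight μ i * compensated k (inc μ i) ≡ addWeight μ i * (content μ i * content μ i) + x * addWeight μ i
  term i i≤n = trans
    (cong₂ (λ y z → addWeight μ i * (y - z + k)) (C1-inc μ i i≤n) (trans (cong triangular (size-inc μ i i≤n)) (triangular-suc (size μ))))
    (l1 (addWeight μ i) (content μ i * content μ i) c (t + m) k)

theorem1p11 : (mu : List ℕ) → IsPartition mu → (n : ℕ) → size mu ≤ n →
    (L : List (List ℕ)) → Unique L →
    (∀ la → (la ∈ L) ⇔ (IsPartition la × size la ≡ n × mu ⊆ la)) →
    sumℚ (map (summand mu) L)
    ≡ ½ * ((ℕ→ℚ n - ℕ→ℚ (size mu)) * (ℕ→ℚ n + ℕ→ℚ (size mu) - 1ℚ))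
theorem1p11 mu pmu n m≤n L u above = begin
  Σℚ (summand mu) L                                              ≡⟨ Σℚ-cong L toExpectation ⟩
  Σℚ (λ la → H * (ℕ→ℚ (numSYT la mu) * (recipHook la * h la))) L ≡⟨ Σℚ-*ˡ H _ L ⟩
  H * expectation mu L h
    ≡⟨ expectation-harmonic (compensated-harmonic k) (n ∸ size mu) mu pmu u
         (subst (λ n → IsPartitionsAbove mu n L) (sym (ℕ.m∸n+n≡m m≤n)) above) ⟩
  h mu                                                           ≡⟨ l2 (ℕ→ℚ (C1 mu)) (ℕ→ℚ (size mu)) (ℕ→ℚ n) ⟩
  ½ * ((ℕ→ℚ n - ℕ→ℚ (size mu)) * (ℕ→ℚ n + ℕ→ℚ (size mu) - 1ℚ)) ∎
  where
  k H : ℚ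
  -- Makes `h la` equal to the difference of `C1 la` and `C1 mu` for `la` of size n, where the
  -- triangular terms cancel. At `mu` the values of `C1` cancel instead, leaving `triangular n` -
  -- `triangular (size mu)`.
  k = triangular n - ℕ→ℚ (C1 mu)
  H = hookProductℚ mu
  h : List ℕ → ℚ
  h = compensated k
  l1 : ∀ H f r a b t → H * f * r * (a - b) ≡ H * (f * (r * (a - t + (t - b))))
  l1 = solve-∀ ring
  l2 : ∀ c m n → c - ½ * (m * (m - 1ℚ)) + (½ * (n * (n - 1ℚ)) - c) ≡ ½ * ((n - m) * (n + m - 1ℚ))
  l2 = solve-∀ ring
  toExpectation : ∀ {la} → la ∈ L → summand mu la ≡ H * (ℕ→ℚ (numSYT la mu) * (recipHook la * h la))
  toExpectation {la} la∈ = begin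
    summand mu la
      ≡⟨ cong (_* (ℕ→ℚ (C1 la) - ℕ→ℚ (C1 mu)))
           (trans (/≡*recip (hookProduct mu ℕ.* numSYT la mu) (hookProduct la) {{hookProduct-nonZero la}})
                  (cong (_* recipHook la) (ℕ→ℚ-* (hookProduct mu) (numSYT la mu)))) ⟩
    H * ℕ→ℚ (numSYT la mu) * recipHook la * (ℕ→ℚ (C1 la) - ℕ→ℚ (C1 mu))
      ≡⟨ l1 H (ℕ→ℚ (numSYT la mu)) (recipHook la) (ℕ→ℚ (C1 la)) (ℕ→ℚ (C1 mu)) (triangular n) ⟩
    H * (ℕ→ℚ (numSYT la mu) * (recipHook la * (ℕ→ℚ (C1 la) - triangular n + k)))
      ≡⟨ cong (λ z → H * (ℕ→ℚ (numSYT la mu) * (recipHook la * (ℕ→ℚ (C1 la) - triangular z + k)))) (proj₁ (proj₂ (to (above la) la∈))) ⟨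
    H * (ℕ→ℚ (numSYT la mu) * (recipHook la * h la)) ∎
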